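{- Let $R$ be a finite set of positive integers with $r=|R|$, let $L$ be an $R$-flag on vertex set $[m]$, and let $s_1,\dots,s_m$ be positive integers. Then $$\pi_n(L(s_1,\dots,s_m))=r-1+O(n^{ -\delta}),\qquad \delta=\frac{\max\{s_i\colon 1\le i\le m\}}{\prod_{i=1}^m s_i}.$$
   Context: A hypergraph $G=(V,E)$ has a finite vertex set and edge set $E\subseteq 2^V$ (edges may have different sizes); $R(G)=\{|F|\colon F\in E\}$, and $G$ is an $R$-graph if $R(G)\subseteq R$. An $R$-flag is an $R$-graph with exactly one edge of each size in $R$. For $G$ on $n$ vertices, $h_n(G)=\sum_{F\in E(G)}1/\binom{n}{|F|}$. $H\subseteq G$ if there is an injective $f\colon V(H)\to V(G)$ with $f(F)\in E(G)$ for all $F\in E(H)$. $\pi_n(H)=\max\{h_n(G)\colon v(G)=n,\ R(G)\subseteq R(H),\ H\not\subseteq G\}$. The blowup $L(s_1,\dots,s_m)$ has vertex set $V_1\sqcup\cdots\sqcup V_m$, $|V_i|=s_i$, and edge set $\bigcup_{F\in E(L)}\prod_{i\in F}V_i$. The $O(\cdot)$ is as $n\to\infty$ with $L$ and the $s_i$ fixed. -}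

module Defs where

open import Data.Bool using (Bool; true; false; if_then_else_)
open import Data.Nat as ℕ using (ℕ; zero; suc; _≤_; _<_; _⊔_; _*_; _≡ᵇ_)
open import Data.Nat.Combinatorics using (_C_)
open import Data.Fin using (Fin; zero; suc) renaming (_≟_ to _≟F_)
open import Data.Fin.Properties using (any?; all?)
open import Data.Fin.Subset using (Subset; _∩_; ∣_∣)
open import Data.Vec using (Vec; []; _∷_; lookup; tabulate; replicate; _++_; map; foldr; sum)
open import Data.List using (List; length)
open import Data.List.Membership.Propositional using (_∈_)
open import Data.Product using (Σ; ∃; ∃-syntax; _×_; _,_)
open import Data.Integer using (+_)
open import Data.Rational using (ℚ; 0ℚ; 1ℚ; _/_; _+_; _-_)
import Data.Rational as Q
open import Function.Definitions using (Injective)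
open import Relation.Binary.PropositionalEquality using (_≡_)
open import Relation.Nullary using (¬_)
open import Relation.Nullary.Decidable using (⌊_⌋; _×-dec_)
open import Data.Bool.Properties using () renaming (_≟_ to _≟B_)

Hypergraph : ℕ → Set
Hypergraph n = Subset n → Bool

_∈E_ : ∀ {n} → Subset n → Hypergraph n → Set
F ∈E G = G F ≡ true

allSubsets : (n : ℕ) → List (Subset n)
allSubsets zero = [] Data.List.∷ Data.List.[]
allSubsets (suc n) =
  Data.List.map (true ∷_) (allSubsets n) Data.List.++ Data.List.map (false ∷_) (allSubsets n)

-- 1/k as a rational (k = 0 is never used below, since binom(n,|F|) ≥ 1)
inv : ℕ → ℚ
inv zero = 0ℚ
inv (suc k) = (+ 1) / suc k

h : ∀ {n} → Hypergraph n → ℚ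
h {n} G = Data.List.foldr _+_ 0ℚ
  (Data.List.map (λ F → if G F then inv (n C ∣ F ∣) else 0ℚ) (allSubsets n))

SizesIn : ∀ {n a} → Hypergraph n → Hypergraph a → Set
SizesIn G H = ∀ F → F ∈E G → ∃[ F' ] (F' ∈E H × ∣ F ∣ ≡ ∣ F' ∣)

image : ∀ {a n} → (Fin a → Fin n) → Subset a → Subset n
image f Q = tabulate (λ w → ⌊ any? (λ v → (lookup Q v ≟B true) ×-dec (f v ≟F w)) ⌋)

_⊆H_ : ∀ {a n} → Hypergraph a → Hypergraph n → Set
H ⊆H G = ∃[ f ] (Injective _≡_ _≡_ f × (∀ F → F ∈E H → image f F ∈E G))

IsFlag : ∀ {m} → List ℕ → Hypergraph m → Set
IsFlag R L =
  (∀ k → k ∈ R → ∃[ F ] (F ∈E L × ∣ F ∣ ≡ k × (∀ F' → F' ∈E L → ∣ F' ∣ ≡ k → F' ≡ F)))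
  × (∀ F → F ∈E L → ∣ F ∣ ∈ R)

-- Blowup L(s_1,…,s_m): vertex set Fin (s_1+⋯+s_m) = V_1 ⊔ ⋯ ⊔ V_m,
-- where the first s_1 vertices form V_1, the next s_2 form V_2, etc.

parts : ∀ {m} → (s : Vec ℕ m) → Vec (Fin m) (sum s)
parts [] = []
parts (k ∷ s) = replicate k zero ++ map suc (parts s)

countPart : ∀ {m} (s : Vec ℕ m) → Fin m → Subset (sum s) → ℕ
countPart s i Q = ∣ Q ∩ map (λ j → ⌊ j ≟F i ⌋) (parts s) ∣

-- Q ∈ ∏_{i ∈ F} V_i for some edge F of L  ⇔  Q meets every part in at most
-- one vertex and the set of parts it meets is an edge of L
blowup : ∀ {m} → Hypergraph m → (s : Vec ℕ m) → Hypergraph (sum s)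
blowup L s Q =
  Data.Bool._∧_ ⌊ all? (λ i → countPart s i Q ℕ.≤? 1) ⌋
                (L (tabulate (λ i → countPart s i Q ≡ᵇ 1)))

Admissible : ∀ {a} → Hypergraph a → (n : ℕ) → Hypergraph n → Set
Admissible H n G = SizesIn G H × ¬ (H ⊆H G)

IsPi : ∀ {a} → Hypergraph a → ℕ → ℚ → Set
IsPi H n x =
  (∃[ G ] (Admissible H n G × h G ≡ x))
  × (∀ G → Admissible H n G → h G Q.≤ x)

_^ℚ_ : ℚ → ℕ → ℚ
q ^ℚ zero = 1ℚ
q ^ℚ suc k = q Q.* (q ^ℚ k)

toℚ : ℕ → ℚ
toℚ k = (+ k) / 1

maxV : ∀ {m} → Vec ℕ m → ℕ
maxV = foldr _ _⊔_ 0

prodV : ∀ {m} → Vec ℕ m → ℕ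
prodV = foldr _ _*_ 1

{-# OPTIONS --safe #-}
module Submission where

open import Defs

-- Lower bound: all sets whose size lies in R minus one element contain no copy of the blowup and have density r − 1.
-- Upper bound: let h(G) = r − 1 + y. A uniformly random injection of [m] into V(G) sends the edge of L of size k
-- to a uniformly random k-set, so the expected number of edges of L it sends to edges of G is h(G); since that number
-- is at most r − 1 unless the injection is a copy of L, at least y (n)_m injections are copies of L.
-- These form a subset of V(G)^m of density of order y, and by Erdős' box argument (convexity of binomial coefficients,
-- one coordinate at a time, a coordinate with the largest s_i last) such a set contains a box with sides s_1, …, s_m,
-- i.e. a copy of the blowup, as soon as y^{∏ s_i / max s_i} n is large.

-- The real exponent -δ never appears. With P the product of all s_i except one largest s_j, the
-- excess satisfies y^P n ≤ D, and raising this to the power s_j gives y^(∏ s_i) n^(max s_i) ≤ C.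
-- Each stage of the box argument has the form t^s ≤ c (w + 1/n) for an old density t and a new
-- density w. The error 1/n comes from comparing d^s with the binomial coefficient C(d, s), which
-- vanishes for d < s. It does no harm: once the other coordinates are boxed, s_j values of
-- coordinate j suffice to complete the box, and these have density s_j/n, of the same order as the
-- error. This is why coordinate j costs only one factor n and s_j stays out of P. Every tuple in
-- the box is an injective copy of L, and two vertices of the blowup in different parts lie on a
-- common transversal, so the images of different parts cannot meet. The expectation is an exact
-- double count of triples (F, φ, Q) with φ an injection carrying the edge F of L onto the edge Q of
-- G.

module FlagBlowup where

  open import Data.Bool using (Bool; true; false; _∧_; _∨_; not; if_then_else_)
  open import Data.Bool.ListAction using (all)
  open import Data.Bool.Properties using (T-≡; not-¬; ∧-zeroʳ; ∧-identityʳ) renaming (_≟_ to _≟B_)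
  open import Data.Empty using (⊥-elim)
  open import Data.Fin using (Fin; zero; suc; punchIn; splitAt; join; inject≤; _↑ʳ_; fromℕ<) renaming (_≟_ to _≟F_)
  open import Data.Fin.Properties using (any?; all?; suc-injective; join-splitAt; inject≤-injective)
  open import Data.Fin.Subset using (Subset; ∣_∣; ⊤; ⊥; ∁; _⊆_; ⁅_⁆; _∩_)
  open import Data.Fin.Subset.Properties using (∣⊤∣≡n; ∣⊥∣≡0; ∣⁅x⁆∣≡1; x∈⁅x⁆; x∈⁅y⁆⇒x≡y; ∣∁p∣≡n∸∣p∣; ∣p∣≤n; p⊆q⇒∣p∣≤∣q∣; drop-∷-⊆; anySubset?)
  import Data.Integer as ℤ
  import Data.Integer.Properties as ℤₚ
  import Data.Integer.Tactic.RingSolver as ℤ-Solver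
  open import Data.List using (List; []; _∷_; _++_; foldr; map; length; tabulate; allFin; cartesianProduct; cartesianProductWith)
  open import Data.List.Membership.Propositional using (_∈_)
  open import Data.List.Membership.Propositional.Properties using (∈-++⁺ˡ; ∈-++⁺ʳ; ∈-map⁺; ∈-cartesianProductWith⁺)
  open import Data.List.Properties using (length-tabulate; length-map; length-++)
  open import Data.List.Relation.Unary.All using (All; []; _∷_)
  import Data.List.Relation.Unary.All as All
  open import Data.List.Relation.Unary.AllPairs using ([]; _∷_)
  import Data.List.Relation.Unary.AllPairs as AllPairs
  open import Data.List.Relation.Unary.Any using (here; there)
  open import Data.List.Relation.Unary.Unique.Propositional using (Unique)
  open import Data.Nat using (ℕ; zero; suc; _+_; _*_; _^_; _∸_; _≤_; _<_; _≡ᵇ_; z≤n; s≤s; NonZero; >-nonZero)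
  import Data.Nat as ℕ
  open import Data.List.Membership.DecPropositional ℕ._≟_ using (_∈?_)
  open import Data.Nat.Combinatorics using (_C_; nCk+nC[k+1]≡[n+1]C[k+1]; k>n⇒nCk≡0)
  open import Data.Nat.Properties hiding (suc-injective)
  open import Data.Nat.Tactic.RingSolver using (solve-∀)
  open import Data.Product using (∃-syntax; _×_; _,_; proj₁; proj₂)
  open import Data.Rational using (ℚ; 0ℚ; 1ℚ; fromℚᵘ; toℚᵘ)
  import Data.Rational as ℚ
  import Data.Rational.Properties as ℚₚ
  open import Data.Rational.Solver using (module +-*-Solver)
  open import Data.Rational.Unnormalised using (ℚᵘ; mkℚᵘ; *≡*; *≤*)
  import Data.Rational.Unnormalised as ℚᵘ
  import Data.Rational.Unnormalised.Properties as ℚᵘₚ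
  open import Data.Sum using (_⊎_; inj₁; inj₂; [_,_]′)
  import Data.Sum as Sum
  open import Data.Vec using (Vec; []; _∷_; lookup; sum; insertAt; removeAt; _[_]≔_; here)
  import Data.Vec as Vec
  open import Data.Vec.Properties using (insertAt-lookup; insertAt-punchIn; insertAt-removeAt; lookup∘tabulate; tabulate∘lookup; tabulate-cong; lookup∘update; lookup∘update′; lookup-map; lookup-replicate; lookup-zipWith; lookup-splitAt; lookup-++ʳ; lookup⇒[]=; []=⇒lookup; ∷-injectiveʳ)
  open import Function using (_∘_; const; id)
  open import Function.Bundles using (Equivalence)
  open import Function.Definitions using (Injective)
  open import Relation.Binary.PropositionalEquality using (_≡_; _≢_; refl; sym; trans; cong; cong₂; subst; subst₂)
  open import Relation.Nullary using (¬_; Dec; yes; no; contradiction; ¬?)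
  open import Relation.Nullary.Decidable using (⌊_⌋; dec-true; isYes≗does; toWitness; map′; _×-dec_; _→-dec_; decidable-stable)

  -- Finite sums

  ∑ : {A : Set} → List A → (A → ℕ) → ℕ
  ∑ []       g = 0
  ∑ (x ∷ xs) g = g x + ∑ xs g

  𝟙 : Bool → ℕ
  𝟙 b = if b then 1 else 0

  𝟙≤1 : ∀ b → 𝟙 b ≤ 1
  𝟙≤1 true  = ≤-refl
  𝟙≤1 false = z≤n

  𝟙-∧ : ∀ a b → 𝟙 (a ∧ b) ≡ 𝟙 a * 𝟙 b
  𝟙-∧ true  b = sym (+-identityʳ (𝟙 b))
  𝟙-∧ false b = refl

  module _ {A : Set} where

    ∑-cong : ∀ (xs : List A) {f g} → (∀ x → f x ≡ g x) → ∑ xs f ≡ ∑ xs g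
    ∑-cong []       e = refl
    ∑-cong (x ∷ xs) e = cong₂ _+_ (e x) (∑-cong xs e)

    ∑-mono : ∀ (xs : List A) {f g} → (∀ x → f x ≤ g x) → ∑ xs f ≤ ∑ xs g
    ∑-mono []       e = z≤n
    ∑-mono (x ∷ xs) e = +-mono-≤ (e x) (∑-mono xs e)

    ∑-mono-∈ : ∀ (xs : List A) {f g} → (∀ x → x ∈ xs → f x ≤ g x) → ∑ xs f ≤ ∑ xs g
    ∑-mono-∈ []       e = z≤n
    ∑-mono-∈ (x ∷ xs) e = +-mono-≤ (e x (here refl)) (∑-mono-∈ xs (λ y → e y ∘ there))

    ∑-distrib-+ : ∀ (xs : List A) f g → ∑ xs (λ x → f x + g x) ≡ ∑ xs f + ∑ xs g
    ∑-distrib-+ []       f g = refl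
    ∑-distrib-+ (x ∷ xs) f g rewrite ∑-distrib-+ xs f g = shuffle (f x) (g x) (∑ xs f) (∑ xs g)
      where
      shuffle : ∀ a b c d → (a + b) + (c + d) ≡ (a + c) + (b + d)
      shuffle = solve-∀

    *-distribˡ-∑ : ∀ c (xs : List A) f → c * ∑ xs f ≡ ∑ xs (λ x → c * f x)
    *-distribˡ-∑ c []       f = *-zeroʳ c
    *-distribˡ-∑ c (x ∷ xs) f =
      trans (*-distribˡ-+ c (f x) (∑ xs f)) (cong (c * f x +_) (*-distribˡ-∑ c xs f))

    *-distribʳ-∑ : ∀ c (xs : List A) f → ∑ xs f * c ≡ ∑ xs (λ x → f x * c)
    *-distribʳ-∑ c []       f = refl
    *-distribʳ-∑ c (x ∷ xs) f =
      trans (*-distribʳ-+ c (f x) (∑ xs f)) (cong (f x * c +_) (*-distribʳ-∑ c xs f))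

    ∑-const : ∀ (xs : List A) c → ∑ xs (λ _ → c) ≡ length xs * c
    ∑-const []       c = refl
    ∑-const (x ∷ xs) c = cong (c +_) (∑-const xs c)

    ∑-zero : ∀ (xs : List A) {f} → (∀ x → f x ≡ 0) → ∑ xs f ≡ 0
    ∑-zero xs e = trans (∑-cong xs e) (trans (∑-const xs 0) (*-zeroʳ (length xs)))

    ∑-++ : ∀ (xs ys : List A) f → ∑ (xs ++ ys) f ≡ ∑ xs f + ∑ ys f
    ∑-++ []       ys f = refl
    ∑-++ (x ∷ xs) ys f =
      trans (cong (f x +_) (∑-++ xs ys f)) (sym (+-assoc (f x) (∑ xs f) (∑ ys f)))

    ∑-map : ∀ {B : Set} (h : B → A) xs f → ∑ (map h xs) f ≡ ∑ xs (f ∘ h)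
    ∑-map h []       f = refl
    ∑-map h (x ∷ xs) f = cong (f (h x) +_) (∑-map h xs f)

    term≤∑ : ∀ {xs : List A} {x} f → x ∈ xs → f x ≤ ∑ xs f
    term≤∑ {y ∷ xs} f (here refl) = m≤m+n (f y) (∑ xs f)
    term≤∑ {y ∷ xs} f (there i)   = ≤-trans (term≤∑ f i) (m≤n+m (∑ xs f) (f y))

  ∑-comm : ∀ {A B : Set} (xs : List A) (ys : List B) (f : A → B → ℕ) →
           ∑ xs (λ x → ∑ ys (f x)) ≡ ∑ ys (λ y → ∑ xs (λ x → f x y))
  ∑-comm []       ys f = sym (∑-zero ys (λ _ → refl))
  ∑-comm (x ∷ xs) ys f =
    trans (cong (∑ ys (f x) +_) (∑-comm xs ys f))
          (sym (∑-distrib-+ ys (f x) (λ y → ∑ xs (λ x′ → f x′ y))))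

  ∑-cartesianProductWith : ∀ {A B D : Set} (h : A → B → D) xs ys f →
    ∑ (cartesianProductWith h xs ys) f ≡ ∑ xs (λ x → ∑ ys (λ y → f (h x y)))
  ∑-cartesianProductWith h []       ys f = refl
  ∑-cartesianProductWith h (x ∷ xs) ys f =
    trans (∑-++ (map (h x) ys) _ f)
          (cong₂ _+_ (∑-map (h x) ys f) (∑-cartesianProductWith h xs ys f))

  -- Averaging and the power mean inequality

  -- The weight w is there to restrict an average over all subsets to those of one size: w is the
  -- indicator of that size, and `0 < w x` then certifies the size of the witness.
  ∃-above-average : ∀ {A : Set} (xs : List A) (w g : A → ℕ) → 0 < ∑ xs w →
    ∃[ x ] (0 < w x × ∑ xs (λ y → w y * g y) ≤ ∑ xs w * g x)
  ∃-above-average (x ∷ xs) w g pos with w x in wx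
  ... | zero = ∃-above-average xs w g pos
  ... | suc a with ∑ xs w ≟ 0
  ... | yes ws = x , subst (0 <_) (sym wx) (s≤s z≤n) , (begin
          suc a * g x + ∑ xs (λ y → w y * g y) ≡⟨ cong (suc a * g x +_) (vanish xs ws) ⟩
          suc a * g x + 0                      ≡⟨ +-identityʳ _ ⟩
          suc a * g x                          ≤⟨ *-monoˡ-≤ (g x) (m≤m+n (suc a) (∑ xs w)) ⟩
          (suc a + ∑ xs w) * g x               ∎)
    where
    open ≤-Reasoning
    vanish : ∀ ys → ∑ ys w ≡ 0 → ∑ ys (λ y → w y * g y) ≡ 0
    vanish []       e = refl
    vanish (y ∷ ys) e rewrite m+n≡0⇒m≡0 (w y) e = vanish ys (m+n≡0⇒n≡0 (w y) e)
  ... | no ws with ∃-above-average xs w g (n≢0⇒n>0 ws)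
  ... | z , wz , le with ≤-total (g x) (g z)
  ... | inj₁ x≤z = z , wz , (begin
          suc a * g x + ∑ xs (λ y → w y * g y) ≤⟨ +-mono-≤ (*-monoʳ-≤ (suc a) x≤z) le ⟩
          suc a * g z + ∑ xs w * g z           ≡⟨ *-distribʳ-+ (g z) (suc a) (∑ xs w) ⟨
          (suc a + ∑ xs w) * g z               ∎)
    where open ≤-Reasoning
  ... | inj₂ z≤x = x , subst (0 <_) (sym wx) (s≤s z≤n) , (begin
          suc a * g x + ∑ xs (λ y → w y * g y) ≤⟨ +-monoʳ-≤ (suc a * g x) (≤-trans le (*-monoʳ-≤ (∑ xs w) z≤x)) ⟩
          suc a * g x + ∑ xs w * g x           ≡⟨ *-distribʳ-+ (g x) (suc a) (∑ xs w) ⟨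
          (suc a + ∑ xs w) * g x               ∎)
    where open ≤-Reasoning

  -- This is (a - b)(a^p - b^p) ≥ 0: both factors have the same sign. The two differences enter as
  -- natural numbers s and t, so nothing is subtracted.
  rearrangement : ∀ p a b → a * b ^ p + a ^ p * b ≤ a * a ^ p + b * b ^ p
  rearrangement p a b with ≤-total a b
  ... | inj₁ a≤b = ordered a b (a ^ p) (b ^ p) a≤b (^-monoˡ-≤ p a≤b)
    where
    open ≤-Reasoning
    ordered : ∀ a b u v → a ≤ b → u ≤ v → a * v + u * b ≤ a * u + b * v
    ordered a b u v a≤b u≤v with m≤n⇒∃[o]m+o≡n a≤b | m≤n⇒∃[o]m+o≡n u≤v
    ... | s , refl | t , refl = ≤-trans (m≤m+n _ (s * t)) (≤-reflexive (expand a s u t))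
      where
      expand : ∀ a s u t → a * (u + t) + u * (a + s) + s * t ≡ a * u + (a + s) * (u + t)
      expand = solve-∀
  ... | inj₂ b≤a with m≤n⇒∃[o]m+o≡n b≤a | m≤n⇒∃[o]m+o≡n (^-monoˡ-≤ p b≤a)
  ... | s , es | t , et = ≤-trans (m≤m+n _ (s * t)) (≤-reflexive
          (subst₂ (λ a u → a * b ^ p + u * b + s * t ≡ a * u + b * b ^ p) es et (expand b s (b ^ p) t)))
      where
      expand : ∀ b s v t → (b + s) * v + (v + t) * b + s * t ≡ (b + s) * (v + t) + b * v
      expand = solve-∀

  module _ {A : Set} (d : A → ℕ) where

    open ≤-Reasoning

    -- Chebyshev's sum inequality for the similarly ordered sequences d and d^p. Splitting off the
    -- head leaves cross terms, which `rearrangement` bounds entry by entry.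
    chebyshev : ∀ p xs → ∑ xs d * ∑ xs (λ x → d x ^ p) ≤ length xs * ∑ xs (λ x → d x * d x ^ p)
    chebyshev p []       = z≤n
    chebyshev p (x ∷ xs) = begin
      (a + ∑ xs d) * (u + ∑ xs (λ y → d y ^ p))
        ≡⟨ expand a u (∑ xs d) (∑ xs (λ y → d y ^ p)) ⟩
      a * u + (a * ∑ xs (λ y → d y ^ p) + u * ∑ xs d) + ∑ xs d * ∑ xs (λ y → d y ^ p)
        ≤⟨ +-mono-≤ (+-monoʳ-≤ (a * u) cross) (chebyshev p xs) ⟩
      a * u + (length xs * (a * u) + E) + length xs * E
        ≡⟨ collect (a * u) (length xs) E ⟩
      suc (length xs) * (a * u + E) ∎
      where
      a = d x
      u = d x ^ p
      E = ∑ xs (λ y → d y * d y ^ p)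
      expand : ∀ a u D U → (a + D) * (u + U) ≡ a * u + (a * U + u * D) + D * U
      expand = solve-∀
      collect : ∀ c l e → c + (l * c + e) + l * e ≡ (1 + l) * (c + e)
      collect = solve-∀
      cross : a * ∑ xs (λ y → d y ^ p) + u * ∑ xs d ≤ length xs * (a * u) + E
      cross = begin
        a * ∑ xs (λ y → d y ^ p) + u * ∑ xs d
          ≡⟨ cong₂ _+_ (*-distribˡ-∑ a xs _) (*-distribˡ-∑ u xs _) ⟩
        ∑ xs (λ y → a * d y ^ p) + ∑ xs (λ y → u * d y)
          ≡⟨ ∑-distrib-+ xs _ _ ⟨
        ∑ xs (λ y → a * d y ^ p + u * d y)
          ≤⟨ ∑-mono xs (λ y → rearrangement p a (d y)) ⟩
        ∑ xs (λ y → a * u + d y * d y ^ p)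
          ≡⟨ ∑-distrib-+ xs _ _ ⟩
        ∑ xs (λ _ → a * u) + E
          ≡⟨ cong (_+ E) (∑-const xs (a * u)) ⟩
        length xs * (a * u) + E ∎

    -- Each further factor `∑ xs d` is absorbed into the sum of powers by `chebyshev`, at the price
    -- of one factor `length xs`.
    power-mean : ∀ p xs → ∑ xs d ^ suc p ≤ length xs ^ p * ∑ xs (λ x → d x ^ suc p)
    power-mean zero    xs = ≤-reflexive (trans (*-identityʳ _)
      (trans (∑-cong xs (λ x → sym (*-identityʳ (d x)))) (sym (*-identityˡ _))))
    power-mean (suc p) xs = begin
      T * T ^ suc p                                        ≤⟨ *-monoʳ-≤ T (power-mean p xs) ⟩
      T * (l ^ p * ∑ xs (λ x → d x ^ suc p))               ≡⟨ swap T (l ^ p) _ ⟩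
      l ^ p * (T * ∑ xs (λ x → d x ^ suc p))               ≤⟨ *-monoʳ-≤ (l ^ p) (chebyshev (suc p) xs) ⟩
      l ^ p * (l * ∑ xs (λ x → d x ^ suc (suc p)))         ≡⟨ assoc (l ^ p) l _ ⟩
      l ^ suc p * ∑ xs (λ x → d x ^ suc (suc p))           ∎
      where
      T = ∑ xs d
      l = length xs
      swap : ∀ a b c → a * (b * c) ≡ b * (a * c)
      swap = solve-∀
      assoc : ∀ a b c → a * (b * c) ≡ b * a * c
      assoc = solve-∀

  -- Binomial coefficients

  C-absorb : ∀ n k → suc k * (suc n C suc k) ≡ suc n * (n C k)
  C-absorb zero zero = refl
  C-absorb zero (suc k) = begin-equality
    suc (suc k) * (1 C suc (suc k)) ≡⟨ cong (suc (suc k) *_) (k>n⇒nCk≡0 {1} {suc (suc k)} (s≤s (s≤s z≤n))) ⟩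
    suc (suc k) * 0                 ≡⟨ *-zeroʳ (suc (suc k)) ⟩
    1 * 0                           ≡⟨ cong (1 *_) (k>n⇒nCk≡0 {0} {suc k} (s≤s z≤n)) ⟨
    1 * (0 C suc k)                 ∎
    where open ≤-Reasoning
  C-absorb (suc n) zero = begin-equality
    1 * (suc (suc n) C 1)       ≡⟨ cong (1 *_) (nCk+nC[k+1]≡[n+1]C[k+1] (suc n) 0) ⟨
    1 * (1 + (suc n C 1))       ≡⟨ *-distribˡ-+ 1 1 (suc n C 1) ⟩
    1 + 1 * (suc n C 1)         ≡⟨ cong (1 +_) (C-absorb n 0) ⟩
    1 + suc n * (n C 0)         ≡⟨⟩
    suc (suc n) * (suc n C 0)   ∎
    where open ≤-Reasoning
  C-absorb (suc n) (suc k) = begin-equality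
    suc (suc k) * (suc (suc n) C suc (suc k))
      ≡⟨ cong (suc (suc k) *_) (nCk+nC[k+1]≡[n+1]C[k+1] (suc n) (suc k)) ⟨
    suc (suc k) * ((suc n C suc k) + (suc n C suc (suc k)))
      ≡⟨ split (suc k) (suc n C suc k) (suc n C suc (suc k)) ⟩
    (suc n C suc k) + suc k * (suc n C suc k) + suc (suc k) * (suc n C suc (suc k))
      ≡⟨ cong₂ (λ a b → (suc n C suc k) + a + b) (C-absorb n k) (C-absorb n (suc k)) ⟩
    (suc n C suc k) + suc n * (n C k) + suc n * (n C suc k)
      ≡⟨ gather (suc n C suc k) (suc n) (n C k) (n C suc k) ⟩
    (suc n C suc k) + suc n * ((n C k) + (n C suc k))
      ≡⟨ cong (λ a → (suc n C suc k) + suc n * a) (nCk+nC[k+1]≡[n+1]C[k+1] n k) ⟩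
    suc (suc n) * (suc n C suc k) ∎
    where
    open ≤-Reasoning
    split : ∀ k a b → (1 + k) * (a + b) ≡ a + k * a + (1 + k) * b
    split = solve-∀
    gather : ∀ c m a b → c + m * a + m * b ≡ c + m * (a + b)
    gather = solve-∀

  -- The companion (N - k) C(N, k) = N C(N - 1, k) of `C-absorb`, with N = suc p + k to avoid
  -- truncated subtraction. It is N times Pascal's rule minus `C-absorb`.
  C-absorb-∸ : ∀ k p → suc p * ((suc p + k) C k) ≡ (suc p + k) * ((p + k) C k)
  C-absorb-∸ zero    p = cong (λ a → suc a * 1) (sym (+-identityʳ p))
  C-absorb-∸ (suc k) p = +-cancelʳ-≡ (suc k * (suc (p + suc k) C suc k)) _ _ (begin-equality
    suc p * (suc (p + suc k) C suc k) + suc k * (suc (p + suc k) C suc k)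
      ≡⟨ *-distribʳ-+ (suc (p + suc k) C suc k) (suc p) (suc k) ⟨
    (suc p + suc k) * (suc (p + suc k) C suc k)
      ≡⟨ cong ((suc p + suc k) *_) (nCk+nC[k+1]≡[n+1]C[k+1] (p + suc k) k) ⟨
    (suc p + suc k) * (((p + suc k) C k) + ((p + suc k) C suc k))
      ≡⟨ expand (suc p + suc k) ((p + suc k) C k) ((p + suc k) C suc k) ⟩
    (suc p + suc k) * ((p + suc k) C suc k) + (suc p + suc k) * ((p + suc k) C k)
      ≡⟨ cong ((suc p + suc k) * ((p + suc k) C suc k) +_) (C-absorb (p + suc k) k) ⟨
    (suc p + suc k) * ((p + suc k) C suc k) + suc k * (suc (p + suc k) C suc k) ∎)
    where
    open ≤-Reasoning
    expand : ∀ m a b → m * (a + b) ≡ m * b + m * a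
    expand = solve-∀

  C≤^ : ∀ n k → n C k ≤ n ^ k
  C≤^ n       zero    = ≤-refl
  C≤^ zero    (suc k) = ≤-reflexive (k>n⇒nCk≡0 {0} {suc k} (s≤s z≤n))
  C≤^ (suc n) (suc k) = begin
    suc n C suc k           ≡⟨ nCk+nC[k+1]≡[n+1]C[k+1] n k ⟨
    (n C k) + (n C suc k)   ≤⟨ +-mono-≤ (C≤^ n k) (C≤^ n (suc k)) ⟩
    n ^ k + n * n ^ k       ≤⟨ *-monoʳ-≤ (suc n) (^-monoˡ-≤ k (n≤1+n n)) ⟩
    suc n * suc n ^ k       ∎
    where open ≤-Reasoning

  C-pos : ∀ n k → k ≤ n → 0 < n C k
  C-pos n       zero    _         = s≤s z≤n
  C-pos (suc n) (suc k) (s≤s k≤n) = <-≤-trans (C-pos n k k≤n)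
    (≤-trans (m≤m+n (n C k) (n C suc k)) (≤-reflexive (nCk+nC[k+1]≡[n+1]C[k+1] n k)))

  -- For d ≥ 2j each factor d − i of d(d−1)⋯(d−j+1) is at least d/2; smaller d only contribute a constant.
  ^≤C : ∀ j → ∃[ c ] (∀ d → d ^ j ≤ c * ((d C j) + 1))
  ^≤C j = (2 * j) ^ j + (2 * j) ^ j , bound
    where
    open ≤-Reasoning
    large : ∀ i d → i ≤ j → 2 * j ≤ d → d ^ i ≤ (2 * j) ^ i * (d C i)
    large zero    d       _   _    = ≤-refl
    large (suc i) zero    i<j 2j≤0 = z≤n
    large (suc i) (suc d) i<j 2j≤d = begin
      suc d * suc d ^ i                             ≤⟨ *-monoʳ-≤ (suc d) (large i (suc d) (<⇒≤ i<j) 2j≤d) ⟩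
      suc d * ((2 * j) ^ i * (suc d C i))           ≡⟨ swap (suc d) ((2 * j) ^ i) (suc d C i) ⟩
      (2 * j) ^ i * (suc d * (suc d C i))           ≤⟨ *-monoʳ-≤ ((2 * j) ^ i) step ⟩
      (2 * j) ^ i * (2 * j * (suc d C suc i))       ≡⟨ assoc ((2 * j) ^ i) (2 * j) (suc d C suc i) ⟩
      2 * j * (2 * j) ^ i * (suc d C suc i)         ∎
      where
      swap : ∀ a b c → a * (b * c) ≡ b * (a * c)
      swap = solve-∀
      assoc : ∀ a b c → a * (b * c) ≡ b * a * c
      assoc = solve-∀
      i≤d : i ≤ d
      i≤d = ≤-pred (≤-trans i<j (≤-trans (m≤n*m j 2) 2j≤d))
      q = d ∸ i
      q+i≡d : q + i ≡ d
      q+i≡d = m∸n+n≡m i≤d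
      halve : suc (q + i) ≤ 2 * suc q
      halve = begin
        suc (q + i)     ≤⟨ s≤s (+-monoʳ-≤ q i≤1+q) ⟩
        suc (q + suc q) ≡⟨ twice q ⟩
        2 * suc q       ∎
        where
        twice : ∀ q → 1 + (q + (1 + q)) ≡ 2 * (1 + q)
        twice = solve-∀
        i≤1+q : i ≤ suc q
        i≤1+q = +-cancelʳ-≤ i i (suc q) (begin
          i + i       ≤⟨ +-mono-≤ (<⇒≤ i<j) (<⇒≤ i<j) ⟩
          j + j       ≡⟨ cong (j +_) (+-identityʳ j) ⟨
          2 * j       ≤⟨ 2j≤d ⟩
          suc d       ≡⟨ cong suc q+i≡d ⟨
          suc q + i   ∎)
      pascal-ratio : suc q * ((suc q + i) C i) ≡ suc i * ((suc q + i) C suc i)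
      pascal-ratio = trans (C-absorb-∸ i q) (sym (C-absorb (q + i) i))
      -- Passing from i to i + 1 costs 2j: the factor 2 from `halve`, and i + 1 ≤ j from the ratio
      -- of consecutive binomial coefficients.
      step : suc d * (suc d C i) ≤ 2 * j * (suc d C suc i)
      step = subst (λ e → suc e * (suc e C i) ≤ 2 * j * (suc e C suc i)) q+i≡d (begin
        suc (q + i) * ((suc q + i) C i)         ≤⟨ *-monoˡ-≤ ((suc q + i) C i) halve ⟩
        2 * suc q * ((suc q + i) C i)           ≡⟨ *-assoc 2 (suc q) _ ⟩
        2 * (suc q * ((suc q + i) C i))         ≡⟨ cong (2 *_) pascal-ratio ⟩
        2 * (suc i * ((suc q + i) C suc i))     ≡⟨ *-assoc 2 (suc i) _ ⟨
        2 * suc i * ((suc q + i) C suc i)       ≤⟨ *-monoˡ-≤ ((suc q + i) C suc i) (*-monoʳ-≤ 2 i<j) ⟩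
        2 * j * ((suc q + i) C suc i)           ∎)
    bound : ∀ d → d ^ j ≤ ((2 * j) ^ j + (2 * j) ^ j) * ((d C j) + 1)
    bound d with ≤-total (2 * j) d
    ... | inj₁ 2j≤d = ≤-trans (large j d ≤-refl 2j≤d)
            (*-mono-≤ (m≤m+n ((2 * j) ^ j) ((2 * j) ^ j)) (m≤m+n (d C j) 1))
    ... | inj₂ d≤2j = ≤-trans (^-monoˡ-≤ j d≤2j) (≤-trans (≤-reflexive (sym (*-identityʳ _)))
            (*-mono-≤ (m≤m+n ((2 * j) ^ j) ((2 * j) ^ j)) (m≤n+m 1 (d C j))))

  -- Powers of products and sums

  ^-distribʳ-* : ∀ p a b → (a * b) ^ p ≡ a ^ p * b ^ p
  ^-distribʳ-* zero    a b = refl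
  ^-distribʳ-* (suc p) a b =
    trans (cong (a * b *_) (^-distribʳ-* p a b)) (shuffle a b (a ^ p) (b ^ p))
    where
    shuffle : ∀ a b c d → a * b * (c * d) ≡ a * c * (b * d)
    shuffle = solve-∀

  -- The sum is at most twice the larger summand.
  +-^-≤ : ∀ p a b → (a + b) ^ p ≤ 2 ^ p * (a ^ p + b ^ p)
  +-^-≤ p a b with ≤-total a b
  ... | inj₁ a≤b = begin
    (a + b) ^ p              ≤⟨ ^-monoˡ-≤ p (+-monoˡ-≤ b a≤b) ⟩
    (b + b) ^ p              ≡⟨ cong (λ c → (b + c) ^ p) (+-identityʳ b) ⟨
    (2 * b) ^ p              ≡⟨ ^-distribʳ-* p 2 b ⟩
    2 ^ p * b ^ p            ≤⟨ *-monoʳ-≤ (2 ^ p) (m≤n+m (b ^ p) (a ^ p)) ⟩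
    2 ^ p * (a ^ p + b ^ p)  ∎
    where open ≤-Reasoning
  ... | inj₂ b≤a = begin
    (a + b) ^ p              ≤⟨ ^-monoˡ-≤ p (+-monoʳ-≤ a b≤a) ⟩
    (a + a) ^ p              ≡⟨ cong (λ c → (a + c) ^ p) (+-identityʳ a) ⟨
    (2 * a) ^ p              ≡⟨ ^-distribʳ-* p 2 a ⟩
    2 ^ p * a ^ p            ≤⟨ *-monoʳ-≤ (2 ^ p) (m≤m+n (a ^ p) (b ^ p)) ⟩
    2 ^ p * (a ^ p + b ^ p)  ∎
    where open ≤-Reasoning

  -- Counting subsets

  _⊆ᵇ_ : ∀ {n} → Subset n → Subset n → Bool
  []      ⊆ᵇ []      = true
  (a ∷ S) ⊆ᵇ (b ∷ N) = (not a ∨ b) ∧ (S ⊆ᵇ N)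

  ⊆ᵇ-sound : ∀ {n} (S N : Subset n) → S ⊆ᵇ N ≡ true → ∀ i → lookup S i ≡ true → lookup N i ≡ true
  ⊆ᵇ-sound (true  ∷ S) (true ∷ N) e zero    i∈S = refl
  ⊆ᵇ-sound (true  ∷ S) (true ∷ N) e (suc i) i∈S = ⊆ᵇ-sound S N e i i∈S
  ⊆ᵇ-sound (false ∷ S) (b    ∷ N) e (suc i) i∈S = ⊆ᵇ-sound S N e i i∈S

  ⊆ᵇ-⊤ : ∀ {n} (S : Subset n) → S ⊆ᵇ ⊤ ≡ true
  ⊆ᵇ-⊤ []          = refl
  ⊆ᵇ-⊤ (true  ∷ S) = ⊆ᵇ-⊤ S
  ⊆ᵇ-⊤ (false ∷ S) = ⊆ᵇ-⊤ S

  ∑-allSubsets : ∀ n f → ∑ (allSubsets (suc n)) f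
               ≡ ∑ (allSubsets n) (f ∘ (true ∷_)) + ∑ (allSubsets n) (f ∘ (false ∷_))
  ∑-allSubsets n f = trans (∑-++ (map (true ∷_) (allSubsets n)) _ f)
    (cong₂ _+_ (∑-map (true ∷_) (allSubsets n) f) (∑-map (false ∷_) (allSubsets n) f))

  #subsets-of : ∀ {n} k (N : Subset n) →
    ∑ (allSubsets n) (λ S → 𝟙 ((∣ S ∣ ≡ᵇ k) ∧ (S ⊆ᵇ N))) ≡ ∣ N ∣ C k
  #subsets-of zero    []          = refl
  #subsets-of (suc k) []          = refl
  #subsets-of {suc n} k (false ∷ N) = trans (∑-allSubsets n _)
    (cong₂ _+_ (∑-zero (allSubsets n) (λ S → cong 𝟙 (∧-zeroʳ (suc ∣ S ∣ ≡ᵇ k)))) (#subsets-of k N))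
  #subsets-of {suc n} zero (true ∷ N) = trans (∑-allSubsets n _)
    (cong₂ _+_ (∑-zero (allSubsets n) (λ S → refl)) (#subsets-of zero N))
  #subsets-of {suc n} (suc k) (true ∷ N) = trans (∑-allSubsets n _)
    (trans (cong₂ _+_ (#subsets-of k N) (#subsets-of (suc k) N)) (nCk+nC[k+1]≡[n+1]C[k+1] ∣ N ∣ k))

  #subsets : ∀ n k → ∑ (allSubsets n) (λ S → 𝟙 (∣ S ∣ ≡ᵇ k)) ≡ n C k
  #subsets n k = trans (∑-cong (allSubsets n) (λ S → cong 𝟙 (sym (within-⊤ S))))
    (trans (#subsets-of k (⊤ {n})) (cong (_C k) (∣⊤∣≡n n)))
    where
    within-⊤ : (S : Subset n) → (∣ S ∣ ≡ᵇ k) ∧ (S ⊆ᵇ ⊤) ≡ (∣ S ∣ ≡ᵇ k)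
    within-⊤ S = trans (cong ((∣ S ∣ ≡ᵇ k) ∧_) (⊆ᵇ-⊤ S)) (∧-identityʳ _)

  ∣tabulate∣ : ∀ {n} (p : Fin n → Bool) → ∣ Vec.tabulate p ∣ ≡ ∑ (allFin n) (𝟙 ∘ p)
  ∣tabulate∣ p = go p (λ i → i)
    where
    -- Generalised over the enumeration f, because the tail of `allFin (suc n)` is tabulated by
    -- `suc` and is not itself an `allFin`.
    go : ∀ {n} {A : Set} (p : A → Bool) (f : Fin n → A) → ∣ Vec.tabulate (p ∘ f) ∣ ≡ ∑ (tabulate f) (𝟙 ∘ p)
    go {zero}  p f = refl
    go {suc n} p f with p (f zero)
    ... | true  = cong suc (go p (f ∘ suc))
    ... | false = go p (f ∘ suc)

  tuples : ∀ n m → List (Vec (Fin n) m)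
  tuples n zero    = [] ∷ []
  tuples n (suc m) = cartesianProductWith _∷_ (allFin n) (tuples n m)

  length-allFin : ∀ n → length (allFin n) ≡ n
  length-allFin n = length-tabulate {n = n} (λ i → i)

  length-cartesianProductWith : ∀ {A B D : Set} (h : A → B → D) xs ys →
    length (cartesianProductWith h xs ys) ≡ length xs * length ys
  length-cartesianProductWith h []       ys = refl
  length-cartesianProductWith h (x ∷ xs) ys = trans (length-++ (map (h x) ys))
    (cong₂ _+_ (length-map (h x) ys) (length-cartesianProductWith h xs ys))

  length-tuples : ∀ n m → length (tuples n m) ≡ n ^ m
  length-tuples n zero    = refl
  length-tuples n (suc m) = trans (length-cartesianProductWith _∷_ (allFin n) (tuples n m))
    (cong₂ _*_ (length-allFin n) (length-tuples n m))

  -- Complete multipartite subsystems of dense relations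

  ≡ᵇ-sound : ∀ m n → 0 < 𝟙 (m ≡ᵇ n) → m ≡ n
  ≡ᵇ-sound m n pos with m ≡ᵇ n in e
  ... | true = ≡ᵇ⇒≡ m n (Equivalence.from T-≡ e)

  -- The Kővári-Sós-Turán count for a bipartite graph with neighbourhoods N y: an average s-set lies
  -- in ∑ C(|N y|, s) / C(n, s) of them, and `power-mean` bounds the numerator below. Divided by (l
  -- n)^s n l, where l = `length ys`, the inequality reads t^s ≤ c (w + 1/n), with t the edge
  -- density and w the fraction of y with S inside N y.
  common-subset : ∀ p → ∃[ c ] (∀ {n} {Y : Set} (ys : List Y) (N : Y → Subset n) → suc p ≤ n →
    ∃[ S ] (∣ S ∣ ≡ suc p ×
      ∑ ys (λ y → ∣ N y ∣) ^ suc p * (n * length ys)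
        ≤ c * ((length ys * n) ^ suc p * (∑ ys (λ y → 𝟙 (S ⊆ᵇ N y)) * n + length ys))))
  common-subset p = c , choose
    where
    s = suc p
    c = proj₁ (^≤C s)
    ^s≤c*C = proj₂ (^≤C s)
    choose : ∀ {n} {Y : Set} (ys : List Y) (N : Y → Subset n) → s ≤ n → _
    choose {n} ys N s≤n
      with ∃-above-average (allSubsets n) (λ S → 𝟙 (∣ S ∣ ≡ᵇ s)) (λ S → ∑ ys (λ y → 𝟙 (S ⊆ᵇ N y)))
             (subst (0 <_) (sym (#subsets n s)) (C-pos n s s≤n))
    ... | S , hit , average = S , ≡ᵇ-sound ∣ S ∣ s hit , bound
      where
      open ≤-Reasoning
      l = length ys
      W = ∑ ys (λ y → 𝟙 (S ⊆ᵇ N y))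
      instance
        n≢0 : NonZero n
        n≢0 = >-nonZero (≤-trans (s≤s z≤n) s≤n)
      double-count : ∑ ys (λ y → ∣ N y ∣ C s) ≤ n ^ s * W
      double-count = begin
        ∑ ys (λ y → ∣ N y ∣ C s)
          ≡⟨ ∑-cong ys (λ y → sym (#subsets-of s (N y))) ⟩
        ∑ ys (λ y → ∑ (allSubsets n) (λ S′ → 𝟙 ((∣ S′ ∣ ≡ᵇ s) ∧ (S′ ⊆ᵇ N y))))
          ≡⟨ ∑-comm ys (allSubsets n) _ ⟩
        ∑ (allSubsets n) (λ S′ → ∑ ys (λ y → 𝟙 ((∣ S′ ∣ ≡ᵇ s) ∧ (S′ ⊆ᵇ N y))))
          ≡⟨ ∑-cong (allSubsets n) (λ S′ → trans (∑-cong ys (λ y → 𝟙-∧ (∣ S′ ∣ ≡ᵇ s) _))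
               (sym (*-distribˡ-∑ (𝟙 (∣ S′ ∣ ≡ᵇ s)) ys (λ y → 𝟙 (S′ ⊆ᵇ N y))))) ⟩
        ∑ (allSubsets n) (λ S′ → 𝟙 (∣ S′ ∣ ≡ᵇ s) * ∑ ys (λ y → 𝟙 (S′ ⊆ᵇ N y)))
          ≤⟨ average ⟩
        ∑ (allSubsets n) (λ S′ → 𝟙 (∣ S′ ∣ ≡ᵇ s)) * W
          ≡⟨ cong (_* W) (#subsets n s) ⟩
        (n C s) * W
          ≤⟨ *-monoˡ-≤ W (C≤^ n s) ⟩
        n ^ s * W ∎
      T^s : ∑ ys (λ y → ∣ N y ∣) ^ s ≤ l ^ p * (c * (n ^ s * W + l))
      T^s = begin
        ∑ ys (λ y → ∣ N y ∣) ^ s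
          ≤⟨ power-mean (λ y → ∣ N y ∣) p ys ⟩
        l ^ p * ∑ ys (λ y → ∣ N y ∣ ^ s)
          ≤⟨ *-monoʳ-≤ (l ^ p) (∑-mono ys (λ y → ^s≤c*C ∣ N y ∣)) ⟩
        l ^ p * ∑ ys (λ y → c * ((∣ N y ∣ C s) + 1))
          ≡⟨ cong (l ^ p *_) (*-distribˡ-∑ c ys (λ y → (∣ N y ∣ C s) + 1)) ⟨
        l ^ p * (c * ∑ ys (λ y → (∣ N y ∣ C s) + 1))
          ≡⟨ cong (λ z → l ^ p * (c * z)) (trans (∑-distrib-+ ys (λ y → ∣ N y ∣ C s) (λ _ → 1))
               (cong (∑ ys (λ y → ∣ N y ∣ C s) +_) (trans (∑-const ys 1) (*-identityʳ l)))) ⟩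
        l ^ p * (c * (∑ ys (λ y → ∣ N y ∣ C s) + l))
          ≤⟨ *-monoʳ-≤ (l ^ p) (*-monoʳ-≤ c (+-monoˡ-≤ l double-count)) ⟩
        l ^ p * (c * (n ^ s * W + l)) ∎
      -- `T^s` has the smaller error 1/n^s; it is relaxed to 1/n so that all stages carry the same
      -- error.
      bound : ∑ ys (λ y → ∣ N y ∣) ^ s * (n * l) ≤ c * ((l * n) ^ s * (W * n + l))
      bound = begin
        ∑ ys (λ y → ∣ N y ∣) ^ s * (n * l)
          ≤⟨ *-monoˡ-≤ (n * l) T^s ⟩
        l ^ p * (c * (n ^ s * W + l)) * (n * l)
          ≡⟨ collect (l ^ p) c (n ^ s) W l n ⟩
        c * (l * l ^ p) * (n ^ s * (W * n) + n * l)
          ≤⟨ *-monoʳ-≤ (c * (l * l ^ p)) (+-monoʳ-≤ (n ^ s * (W * n)) (*-monoˡ-≤ l (m≤m*n n (n ^ p) {{m^n≢0 n p}}))) ⟩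
        c * (l * l ^ p) * (n ^ s * (W * n) + n ^ s * l)
          ≡⟨ factor c (l ^ s) (n ^ s) (W * n) l ⟩
        c * ((l ^ s * n ^ s) * (W * n + l))
          ≡⟨ cong (λ z → c * (z * (W * n + l))) (^-distribʳ-* s l n) ⟨
        c * ((l * n) ^ s * (W * n + l)) ∎
        where
        collect : ∀ lp c ns W l n → lp * (c * (ns * W + l)) * (n * l) ≡ c * (l * lp) * (ns * (W * n) + n * l)
        collect = solve-∀
        factor : ∀ c ls ns a l → c * ls * (ns * a + ns * l) ≡ c * ((ls * ns) * (a + l))
        factor = solve-∀

  -- In terms of the densities t = T/(l₁n), t₁ = T₁/l₁ and w = W/l, from tˢ ≤ c₁(t₁ + 1/n) and t₁ᴾ ≤ c₂(w + 1/n)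
  -- one gets tˢᴾ ≤ c(w + 1/n); all inequalities of this kind are stated with denominators cleared.
  compose-densities : ∀ {T T₁ n l l₁ W c₁ c₂} s P → 0 < n → 0 < l₁ → 0 < P →
    T ^ s * (n * l₁) ≤ c₁ * ((l₁ * n) ^ s * (T₁ * n + l₁)) →
    T₁ ^ P * (n * l) ≤ c₂ * (l₁ ^ P * (W * n + l)) →
    T ^ (s * P) * (n * l) ≤ c₁ ^ P * 2 ^ P * (c₂ + 1) * ((l₁ * n) ^ (s * P) * (W * n + l))
  compose-densities {T} {T₁} {n} {l} {l₁} {W} {c₁} {c₂} s P 0<n 0<l₁ 0<P h₁ h₂ = *-cancelˡ-≤ K (begin
    K * (T ^ (s * P) * (n * l))
      ≡⟨ cong (λ z → K * (z * (n * l))) (^-*-assoc T s P) ⟨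
    K * ((T ^ s) ^ P * (n * l))
      ≡⟨ rotate K ((T ^ s) ^ P) (n * l) ⟩
    (T ^ s) ^ P * K * (n * l)
      ≡⟨ cong (_* (n * l)) (^-distribʳ-* P (T ^ s) (n * l₁)) ⟨
    (T ^ s * (n * l₁)) ^ P * (n * l)
      ≤⟨ *-monoˡ-≤ (n * l) (^-monoˡ-≤ P h₁) ⟩
    (c₁ * ((l₁ * n) ^ s * (T₁ * n + l₁))) ^ P * (n * l)
      ≡⟨ cong (_* (n * l)) (trans (^-distribʳ-* P c₁ _) (cong (c₁ ^ P *_)
           (trans (^-distribʳ-* P ((l₁ * n) ^ s) _) (cong (_* (T₁ * n + l₁) ^ P) (^-*-assoc (l₁ * n) s P))))) ⟩
    c₁ ^ P * (M * (T₁ * n + l₁) ^ P) * (n * l)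
      ≤⟨ *-monoˡ-≤ (n * l) (*-monoʳ-≤ (c₁ ^ P) (*-monoʳ-≤ M (+-^-≤ P (T₁ * n) l₁))) ⟩
    c₁ ^ P * (M * (2 ^ P * ((T₁ * n) ^ P + l₁ ^ P))) * (n * l)
      ≡⟨ cong (λ z → c₁ ^ P * (M * (2 ^ P * (z + l₁ ^ P))) * (n * l)) (^-distribʳ-* P T₁ n) ⟩
    c₁ ^ P * (M * (2 ^ P * (T₁ ^ P * n ^ P + l₁ ^ P))) * (n * l)
      ≡⟨ regroup (c₁ ^ P) M (2 ^ P) (T₁ ^ P) (n ^ P) (l₁ ^ P) n l ⟩
    c₁ ^ P * 2 ^ P * M * (n ^ P * (T₁ ^ P * (n * l)) + n * (l₁ ^ P * l))
      ≤⟨ *-monoʳ-≤ (c₁ ^ P * 2 ^ P * M) (+-mono-≤ (*-monoʳ-≤ (n ^ P) h₂)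
           (*-mono-≤ n≤n^P (*-monoʳ-≤ (l₁ ^ P) (m≤n+m l (W * n))))) ⟩
    c₁ ^ P * 2 ^ P * M * (n ^ P * (c₂ * (l₁ ^ P * (W * n + l))) + n ^ P * (l₁ ^ P * (W * n + l)))
      ≡⟨ factor (c₁ ^ P) (2 ^ P) M (n ^ P) c₂ (l₁ ^ P) (W * n + l) ⟩
    (n ^ P * l₁ ^ P) * (c₁ ^ P * 2 ^ P * (c₂ + 1) * (M * (W * n + l)))
      ≡⟨ cong (_* (c₁ ^ P * 2 ^ P * (c₂ + 1) * (M * (W * n + l)))) (^-distribʳ-* P n l₁) ⟨
    K * (c₁ ^ P * 2 ^ P * (c₂ + 1) * (M * (W * n + l))) ∎)
    where
    open ≤-Reasoning
    -- Both sides are multiplied by K so that the first hypothesis can be raised to the power P with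
    -- its denominator in place.
    K = (n * l₁) ^ P
    M = (l₁ * n) ^ (s * P)
    instance
      n≢0 : NonZero n
      n≢0 = >-nonZero 0<n
      l₁≢0 : NonZero l₁
      l₁≢0 = >-nonZero 0<l₁
      K≢0 : NonZero K
      K≢0 = m^n≢0 (n * l₁) P {{m*n≢0 n l₁}}
    -- Relaxes the error 1/n^P, left by expanding (t₁ + 1/n)^P, to 1/n. Here P must be positive.
    n≤n^P : n ≤ n ^ P
    n≤n^P = ≤-trans (≤-reflexive (sym (^-identityʳ n))) (^-monoʳ-≤ n 0<P)
    rotate : ∀ K a b → K * (a * b) ≡ a * K * b
    rotate = solve-∀
    regroup : ∀ c M t T N L n l → c * (M * (t * (T * N + L))) * (n * l) ≡ c * t * M * (N * (T * (n * l)) + n * (L * l))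
    regroup = solve-∀
    factor : ∀ c t M N d L w → c * t * M * (N * (d * (L * w)) + N * (L * w)) ≡ (N * L) * (c * t * (d + 1) * (M * w))
    factor = solve-∀

  link : ∀ {n k} → Subset n → (Vec (Fin n) (suc k) → Bool) → Vec (Fin n) k → Bool
  link S A v = S ⊆ᵇ Vec.tabulate (λ a → A (a ∷ v))

  -- Tests whether the product of the Ss lies inside A. Recursion through common links follows the
  -- induction of `box-density`, where S is fixed and A is replaced by its link.
  boxᵇ : ∀ {n k} → Vec (Subset n) k → (Vec (Fin n) k → Bool) → Bool
  boxᵇ []       A = A []
  boxᵇ (S ∷ Ss) A = boxᵇ Ss (link S A)

  boxᵇ-sound : ∀ {n k} (Ss : Vec (Subset n) k) A → boxᵇ Ss A ≡ true →
    ∀ φ → (∀ i → lookup (lookup Ss i) (lookup φ i) ≡ true) → A φ ≡ true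
  boxᵇ-sound []       A e []      φ∈ = e
  boxᵇ-sound (S ∷ Ss) A e (a ∷ φ) φ∈ =
    trans (sym (lookup∘tabulate (λ b → A (b ∷ φ)) a))
      (⊆ᵇ-sound S _ (boxᵇ-sound Ss (link S A) e φ (φ∈ ∘ suc)) a (φ∈ zero))

  prodV-pos : ∀ {k} (s : Vec ℕ k) → (∀ i → 0 < lookup s i) → 0 < prodV s
  prodV-pos []      pos = s≤s z≤n
  prodV-pos (a ∷ s) pos = *-mono-≤ (pos zero) (prodV-pos s (pos ∘ suc))

  -- In densities, t^P ≤ c (w + 1/n), where w is the fraction of x for which one common box lies
  -- inside A x. The family over x is essential: `box-or-sparse` takes the last coordinate as x, so
  -- that w measures the completions of a single box. The induction picks S for the first coordinate
  -- and continues with the family of links of S.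
  box-density : ∀ {k} (s : Vec ℕ k) → (∀ i → 0 < lookup s i) →
    ∃[ c ] (∀ {n} {X : Set} (xs : List X) (A : X → Vec (Fin n) k → Bool) →
      0 < n → 0 < length xs → (∀ i → lookup s i ≤ n) →
      ∃[ Ss ] ((∀ i → ∣ lookup Ss i ∣ ≡ lookup s i) ×
        ∑ xs (λ x → ∑ (tuples n k) (𝟙 ∘ A x)) ^ prodV s * (n * length xs)
          ≤ c * ((length xs * n ^ k) ^ prodV s * (∑ xs (λ x → 𝟙 (boxᵇ Ss (A x))) * n + length xs))))
  box-density []          pos = 1 , λ {n} xs A 0<n 0<l s≤n → [] , (λ ()) , base n xs A
    where
    open ≤-Reasoning
    base : ∀ n {X : Set} (xs : List X) (A : X → Vec (Fin n) 0 → Bool) → _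
    base n xs A = begin
      ∑ xs (λ x → 𝟙 (A x []) + 0) ^ 1 * (n * length xs)
        ≡⟨ cong (λ z → z ^ 1 * (n * length xs)) (∑-cong xs (λ x → +-identityʳ _)) ⟩
      W ^ 1 * (n * length xs)
        ≡⟨ cong (_* (n * length xs)) (^-identityʳ W) ⟩
      W * (n * length xs)
        ≤⟨ m≤m+n _ (length xs * length xs) ⟩
      W * (n * length xs) + length xs * length xs
        ≡⟨ arrange W n (length xs) ⟩
      1 * ((length xs * 1) * (W * n + length xs))
        ≡⟨ cong (λ z → 1 * (z * (W * n + length xs))) (^-identityʳ (length xs * 1)) ⟨
      1 * ((length xs * 1) ^ 1 * (W * n + length xs)) ∎
      where
      W = ∑ xs (λ x → 𝟙 (A x []))
      arrange : ∀ W n l → W * (n * l) + l * l ≡ 1 * ((l * 1) * (W * n + l))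
      arrange = solve-∀
  box-density {suc k} (zero  ∷ s) pos = contradiction (pos zero) (λ ())
  box-density {suc k} (suc p ∷ s) pos = c , go
    where
    P = prodV s
    c₁ = proj₁ (common-subset p)
    first = proj₂ (common-subset p)
    c₂ = proj₁ (box-density s (pos ∘ suc))
    rest = proj₂ (box-density s (pos ∘ suc))
    c = c₁ ^ P * 2 ^ P * (c₂ + 1)
    go : ∀ {n} {X : Set} (xs : List X) (A : X → Vec (Fin n) (suc k) → Bool) →
      0 < n → 0 < length xs → (∀ i → lookup (suc p ∷ s) i ≤ n) → _
    go {n} {X} xs A 0<n 0<l s≤n = S ∷ Ss , (λ { zero → proj₁ (proj₂ head) ; (suc i) → proj₁ (proj₂ tail) i }) ,
        subst (λ z → T ^ (suc p * P) * (n * l) ≤ c * (z ^ (suc p * P) * (W * n + l)))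
          (trans (*-assoc l (n ^ k) n) (cong (l *_) (*-comm (n ^ k) n)))
          (compose-densities {T = T} {T₁ = T₁} {W = W} {c₁ = c₁} {c₂ = c₂} (suc p) P 0<n 0<l₁ (prodV-pos s (pos ∘ suc)) h₁′ h₂)
      where
      -- One side of a bipartite graph consists of the pairs (x, v), the other of the values of the
      -- first coordinate.
      ys = cartesianProduct xs (tuples n k)
      nbhd : X × Vec (Fin n) k → Subset n
      nbhd (x , v) = Vec.tabulate (λ a → A x (a ∷ v))
      head = first ys nbhd (s≤n zero)
      S = proj₁ head
      h₁ = proj₂ (proj₂ head)
      tail = rest xs (λ x → link S (A x)) 0<n 0<l (s≤n ∘ suc)
      Ss = proj₁ tail
      h₂ = proj₂ (proj₂ tail)
      l = length xs
      T = ∑ xs (λ x → ∑ (tuples n (suc k)) (𝟙 ∘ A x))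
      T₁ = ∑ xs (λ x → ∑ (tuples n k) (𝟙 ∘ link S (A x)))
      W = ∑ xs (λ x → 𝟙 (boxᵇ Ss (link S (A x))))
      0<l₁ : 0 < l * n ^ k
      0<l₁ = *-mono-≤ 0<l (m^n>0 n {{>-nonZero 0<n}} k)
      ∣ys∣ : length ys ≡ l * n ^ k
      ∣ys∣ = trans (length-cartesianProductWith _,_ xs (tuples n k)) (cong (l *_) (length-tuples n k))
      total : ∑ ys (λ y → ∣ nbhd y ∣) ≡ T
      total = trans (∑-cartesianProductWith _,_ xs (tuples n k) _) (∑-cong xs (λ x →
        trans (∑-cong (tuples n k) (λ v → ∣tabulate∣ (λ a → A x (a ∷ v))))
        (trans (∑-comm (tuples n k) (allFin n) (λ v a → 𝟙 (A x (a ∷ v))))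
               (sym (∑-cartesianProductWith _∷_ (allFin n) (tuples n k) (𝟙 ∘ A x))))))
      remaining : ∑ ys (λ y → 𝟙 (S ⊆ᵇ nbhd y)) ≡ T₁
      remaining = ∑-cartesianProductWith _,_ xs (tuples n k) _
      h₁′ : T ^ suc p * (n * (l * n ^ k)) ≤ c₁ * ((l * n ^ k * n) ^ suc p * (T₁ * n + l * n ^ k))
      h₁′ = subst₂ (λ t t₁ → t ^ suc p * (n * (l * n ^ k)) ≤ c₁ * ((l * n ^ k * n) ^ suc p * (t₁ * n + l * n ^ k)))
        total remaining (subst (λ z → ∑ ys (λ y → ∣ nbhd y ∣) ^ suc p * (n * z)
                                 ≤ c₁ * ((z * n) ^ suc p * (∑ ys (λ y → 𝟙 (S ⊆ᵇ nbhd y)) * n + z))) ∣ys∣ h₁)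

  -- Boxes with a distinguished coordinate

  insertAt-pointwise⁺ : ∀ {A B : Set} (R : A → B → Set) {k} (xs : Vec A k) (ys : Vec B k) {x y} j →
    (∀ i → R (lookup xs i) (lookup ys i)) → R x y →
    ∀ i → R (lookup (insertAt xs j x) i) (lookup (insertAt ys j y) i)
  insertAt-pointwise⁺ R xs       ys       zero    rs r zero    = r
  insertAt-pointwise⁺ R xs       ys       zero    rs r (suc i) = rs i
  insertAt-pointwise⁺ R (x ∷ xs) (y ∷ ys) (suc j) rs r zero    = rs zero
  insertAt-pointwise⁺ R (x ∷ xs) (y ∷ ys) (suc j) rs r (suc i) = insertAt-pointwise⁺ R xs ys j (rs ∘ suc) r i

  -- Only the order of summation changes. This frees the distinguished coordinate from being the
  -- head of the tuple.
  ∑-tuples-insertAt : ∀ n {k} (j : Fin (suc k)) (f : Vec (Fin n) (suc k) → ℕ) →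
    ∑ (allFin n) (λ x → ∑ (tuples n k) (λ v → f (insertAt v j x))) ≡ ∑ (tuples n (suc k)) f
  ∑-tuples-insertAt n {k}     zero    f = sym (∑-cartesianProductWith _∷_ (allFin n) (tuples n k) f)
  ∑-tuples-insertAt n {suc k} (suc j) f = trans
    (∑-cong (allFin n) (λ x → ∑-cartesianProductWith _∷_ (allFin n) (tuples n k) (λ v → f (insertAt v (suc j) x))))
    (trans (∑-comm (allFin n) (allFin n) _)
    (trans (∑-cong (allFin n) (λ y → ∑-tuples-insertAt n j (f ∘ (y ∷_))))
           (sym (∑-cartesianProductWith _∷_ (allFin n) (tuples n (suc k)) f))))

  lookup-removeAt : ∀ {A : Set} {k} (xs : Vec A (suc k)) j i → lookup (removeAt xs j) i ≡ lookup xs (punchIn j i)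
  lookup-removeAt xs j i = trans (sym (insertAt-punchIn (removeAt xs j) j (lookup xs j) i))
    (cong (λ ys → lookup ys (punchIn j i)) (insertAt-removeAt xs j))

  -- The sides may exceed the s_i, because the side at coordinate j is taken to be the set of all
  -- completions.
  ContainsBox : ∀ {n k} → Vec ℕ k → (Vec (Fin n) k → Bool) → Set
  ContainsBox {n} {k} s A = ∃[ Ss ] ((∀ i → lookup s i ≤ ∣ lookup Ss i ∣) ×
    (∀ φ → (∀ i → lookup (lookup Ss i) (lookup φ i) ≡ true) → A φ ≡ true))

  -- The coordinate j is treated last: there mere existence of s_j completions is needed, so s_j does not enter the exponent.
  box-or-sparse : ∀ {k} (s : Vec ℕ (suc k)) j → (∀ i → 0 < lookup s i) →
    ∃[ c ] (∀ {n} (A : Vec (Fin n) (suc k) → Bool) → 0 < n → (∀ i → lookup s i ≤ n) →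
      ContainsBox s A ⊎
      ∑ (tuples n (suc k)) (𝟙 ∘ A) ^ prodV (removeAt s j) * n ≤ c * (n ^ suc k) ^ prodV (removeAt s j))
  box-or-sparse {k} s j pos = c * (lookup s j + 1) , go
    where
    density = box-density (removeAt s j) (λ i → subst (0 <_) (sym (lookup-removeAt s j i)) (pos (punchIn j i)))
    c = proj₁ density
    dense = proj₂ density
    P = prodV (removeAt s j)
    go : ∀ {n} (A : Vec (Fin n) (suc k) → Bool) → 0 < n → (∀ i → lookup s i ≤ n) → _
    go {n} A 0<n s≤n = Sum.map contains sparse (≤-total (lookup s j) W)
      where
      open ≤-Reasoning
      instance
        n≢0 : NonZero n
        n≢0 = >-nonZero 0<n
      completion = dense (allFin n) (λ x v → A (insertAt v j x)) 0<n (subst (0 <_) (sym (length-allFin n)) 0<n)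
        (λ i → subst (_≤ n) (sym (lookup-removeAt s j i)) (s≤n (punchIn j i)))
      Ss = proj₁ completion
      S : Subset n
      S = Vec.tabulate (λ x → boxᵇ Ss (λ v → A (insertAt v j x)))
      T = ∑ (tuples n (suc k)) (𝟙 ∘ A)
      W = ∑ (allFin n) (λ x → 𝟙 (boxᵇ Ss (λ v → A (insertAt v j x))))
      contains : lookup s j ≤ W → ContainsBox s A
      contains sⱼ≤W = insertAt Ss j S , sizes , sound
        where
        sizes : ∀ i → lookup s i ≤ ∣ lookup (insertAt Ss j S) i ∣
        sizes i = subst (λ t → lookup t i ≤ ∣ lookup (insertAt Ss j S) i ∣) (insertAt-removeAt s j)
          (insertAt-pointwise⁺ (λ a T → a ≤ ∣ T ∣) (removeAt s j) Ss j
            (λ i → ≤-reflexive (sym (proj₁ (proj₂ completion) i)))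
            (≤-trans sⱼ≤W (≤-reflexive (sym (∣tabulate∣ (λ x → boxᵇ Ss (λ v → A (insertAt v j x))))))) i)
        sound : ∀ φ → (∀ i → lookup (lookup (insertAt Ss j S) i) (lookup φ i) ≡ true) → A φ ≡ true
        sound φ φ∈ = trans (cong A (sym (insertAt-removeAt φ j)))
          (boxᵇ-sound Ss (λ v → A (insertAt v j (lookup φ j)))
            (trans (sym (lookup∘tabulate _ (lookup φ j)))
                   (subst (λ T → lookup T (lookup φ j) ≡ true) (insertAt-lookup Ss j S) (φ∈ j)))
            (removeAt φ j)
            (λ i → subst₂ (λ T a → lookup T a ≡ true) (insertAt-punchIn Ss j S i)
                     (sym (lookup-removeAt φ j i)) (φ∈ (punchIn j i))))
      -- Few completions mean w ≤ s_j/n, hence w + 1/n ≤ (s_j + 1)/n; this is the origin of the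
      -- factor s_j + 1 in the constant.
      sparse : W ≤ lookup s j → T ^ P * n ≤ c * (lookup s j + 1) * (n ^ suc k) ^ P
      sparse W≤sⱼ = *-cancelʳ-≤ _ _ n (begin
        T ^ P * n * n
          ≡⟨ *-assoc (T ^ P) n n ⟩
        T ^ P * (n * n)
          ≡⟨ cong₂ (λ t l → t ^ P * (n * l)) (∑-tuples-insertAt n j (𝟙 ∘ A)) (length-allFin n) ⟨
        ∑ (allFin n) (λ x → ∑ (tuples n k) (λ v → 𝟙 (A (insertAt v j x)))) ^ P * (n * length (allFin n))
          ≤⟨ proj₂ (proj₂ completion) ⟩
        c * ((length (allFin n) * n ^ k) ^ P * (W * n + length (allFin n)))
          ≡⟨ cong (λ l → c * ((l * n ^ k) ^ P * (W * n + l))) (length-allFin n) ⟩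
        c * ((n * n ^ k) ^ P * (W * n + n))
          ≤⟨ *-monoʳ-≤ c (*-monoʳ-≤ ((n * n ^ k) ^ P) (+-monoˡ-≤ n (*-monoˡ-≤ n W≤sⱼ))) ⟩
        c * ((n * n ^ k) ^ P * (lookup s j * n + n))
          ≡⟨ factor c ((n * n ^ k) ^ P) (lookup s j) n ⟩
        c * (lookup s j + 1) * (n * n ^ k) ^ P * n ∎)
        where
        factor : ∀ c N a n → c * (N * (a * n + n)) ≡ c * (a + 1) * N * n
        factor = solve-∀

  -- Images of subsets

  true-ext : ∀ {a b} → (a ≡ true → b ≡ true) → (b ≡ true → a ≡ true) → a ≡ b
  true-ext {true}          f g = sym (f refl)
  true-ext {false} {true}  f g = g refl
  true-ext {false} {false} f g = refl

  subset-ext : ∀ {n} (P Q : Subset n) → (∀ w → lookup P w ≡ true → lookup Q w ≡ true) →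
               (∀ w → lookup Q w ≡ true → lookup P w ≡ true) → P ≡ Q
  subset-ext P Q f g = trans (sym (tabulate∘lookup P))
    (trans (tabulate-cong (λ w → true-ext (f w) (g w))) (tabulate∘lookup Q))

  ∧-true : ∀ {a b} → a ∧ b ≡ true → a ≡ true × b ≡ true
  ∧-true {true} e = refl , e

  module _ {a n} (f : Fin a → Fin n) (Q : Subset a) where

    ∈-image⁺ : ∀ v → lookup Q v ≡ true → lookup (image f Q) (f v) ≡ true
    ∈-image⁺ v v∈Q = trans (lookup∘tabulate _ (f v)) (trans (isYes≗does _) (dec-true (any? _) (v , v∈Q , refl)))

    ∈-image⁻ : ∀ w → lookup (image f Q) w ≡ true → ∃[ v ] (lookup Q v ≡ true × f v ≡ w)
    ∈-image⁻ w w∈ with any? (λ v → (lookup Q v ≟B true) ×-dec (f v ≟F w)) | trans (sym (lookup∘tabulate _ w)) w∈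
    ... | yes found | _ = found

  image-cong : ∀ {a n} {f g : Fin a → Fin n} → (∀ v → f v ≡ g v) → ∀ Q → image f Q ≡ image g Q
  image-cong {f = f} {g} f≗g Q = subset-ext (image f Q) (image g Q) (transfer f g f≗g) (transfer g f (sym ∘ f≗g))
    where
    transfer : ∀ f g → (∀ v → f v ≡ g v) → ∀ w → lookup (image f Q) w ≡ true → lookup (image g Q) w ≡ true
    transfer f g f≗g w w∈ with ∈-image⁻ f Q w w∈
    ... | v , v∈Q , refl = subst (λ z → lookup (image g Q) z ≡ true) (sym (f≗g v)) (∈-image⁺ g Q v v∈Q)

  ∣insert∣ : ∀ {n} (S : Subset n) x → lookup S x ≡ false → ∣ S [ x ]≔ true ∣ ≡ suc ∣ S ∣
  ∣insert∣ (false ∷ S) zero    e = refl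
  ∣insert∣ (true  ∷ S) (suc x) e = cong suc (∣insert∣ S x e)
  ∣insert∣ (false ∷ S) (suc x) e = ∣insert∣ S x e

  ∣delete∣ : ∀ {n} (S : Subset n) x → lookup S x ≡ true → ∣ S [ x ]≔ false ∣ ≡ ∣ S ∣ ∸ 1
  ∣delete∣ (true  ∷ S) zero    e = refl
  ∣delete∣ (false ∷ S) (suc x) e = ∣delete∣ S x e
  ∣delete∣ (true  ∷ S) (suc x) e = trans (cong suc (∣delete∣ S x e)) (positive S x e)
    where
    positive : ∀ {n} (S : Subset n) x → lookup S x ≡ true → suc (∣ S ∣ ∸ 1) ≡ ∣ S ∣
    positive (true  ∷ S) x       e = refl
    positive (false ∷ S) (suc x) e = positive S x e

  ∣image∣ : ∀ {a n} (f : Fin a → Fin n) → Injective _≡_ _≡_ f → ∀ Q → ∣ image f Q ∣ ≡ ∣ Q ∣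
  ∣image∣ {zero} {n} f inj [] = trans (cong ∣_∣ (subset-ext (image f []) ⊥ nothing (λ w e → contradiction (trans (sym e) (lookup-replicate w false)) (λ ())))) (∣⊥∣≡0 n)
    where
    nothing : ∀ w → lookup (image f []) w ≡ true → lookup ⊥ w ≡ true
    nothing w w∈ with ∈-image⁻ f [] w w∈
    ... | () , _
  ∣image∣ {suc a} f inj (false ∷ Q) = trans (cong ∣_∣ (subset-ext (image f (false ∷ Q)) (image (f ∘ suc) Q) shrink extend)) (∣image∣ (f ∘ suc) (suc-injective ∘ inj) Q)
    where
    shrink : ∀ w → lookup (image f (false ∷ Q)) w ≡ true → lookup (image (f ∘ suc) Q) w ≡ true
    shrink w w∈ with ∈-image⁻ f (false ∷ Q) w w∈
    ... | suc v , v∈Q , refl = ∈-image⁺ (f ∘ suc) Q v v∈Q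
    extend : ∀ w → lookup (image (f ∘ suc) Q) w ≡ true → lookup (image f (false ∷ Q)) w ≡ true
    extend w w∈ with ∈-image⁻ (f ∘ suc) Q w w∈
    ... | v , v∈Q , refl = ∈-image⁺ f (false ∷ Q) (suc v) v∈Q
  ∣image∣ {suc a} f inj (true ∷ Q) = trans (cong ∣_∣ (subset-ext (image f (true ∷ Q)) (I [ f zero ]≔ true) split gather))
    (trans (∣insert∣ I (f zero) new) (cong suc (∣image∣ (f ∘ suc) (suc-injective ∘ inj) Q)))
    where
    I = image (f ∘ suc) Q
    new : lookup I (f zero) ≡ false
    new with lookup I (f zero) in e
    ... | false = refl
    ... | true with ∈-image⁻ (f ∘ suc) Q (f zero) e
    ... | v , _ , fv≡f0 with inj fv≡f0
    ... | ()
    split : ∀ w → lookup (image f (true ∷ Q)) w ≡ true → lookup (I [ f zero ]≔ true) w ≡ true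
    split w w∈ with ∈-image⁻ f (true ∷ Q) w w∈
    ... | zero  , _   , refl = lookup∘update (f zero) I true
    ... | suc v , v∈Q , refl = trans (lookup∘update′ (λ e → contradiction (inj e) (λ ())) I true) (∈-image⁺ (f ∘ suc) Q v v∈Q)
    gather : ∀ w → lookup (I [ f zero ]≔ true) w ≡ true → lookup (image f (true ∷ Q)) w ≡ true
    gather w w∈ with w ≟F f zero
    ... | yes refl = ∈-image⁺ f (true ∷ Q) zero refl
    ... | no  w≢f0 with ∈-image⁻ (f ∘ suc) Q w (trans (sym (lookup∘update′ w≢f0 I true)) w∈)
    ... | v , v∈Q , refl = ∈-image⁺ f (true ∷ Q) (suc v) v∈Q

  ⊆∧∣≥∣⇒≡ : ∀ {n} (P Q : Subset n) → P ⊆ Q → ∣ Q ∣ ≤ ∣ P ∣ → P ≡ Q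
  ⊆∧∣≥∣⇒≡ []          []          P⊆Q le = refl
  ⊆∧∣≥∣⇒≡ (true  ∷ P) (true  ∷ Q) P⊆Q le = cong (true ∷_) (⊆∧∣≥∣⇒≡ P Q (drop-∷-⊆ P⊆Q) (≤-pred le))
  ⊆∧∣≥∣⇒≡ (true  ∷ P) (false ∷ Q) P⊆Q le with P⊆Q here
  ... | ()
  ⊆∧∣≥∣⇒≡ (false ∷ P) (true  ∷ Q) P⊆Q le = contradiction (p⊆q⇒∣p∣≤∣q∣ (drop-∷-⊆ P⊆Q)) (<⇒≱ le)
  ⊆∧∣≥∣⇒≡ (false ∷ P) (false ∷ Q) P⊆Q le = cong (false ∷_) (⊆∧∣≥∣⇒≡ P Q (drop-∷-⊆ P⊆Q) le)

  ∈-allSubsets : ∀ {n} (S : Subset n) → S ∈ allSubsets n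
  ∈-allSubsets []          = here refl
  ∈-allSubsets (true  ∷ S) = ∈-++⁺ˡ (∈-map⁺ (true ∷_) (∈-allSubsets S))
  ∈-allSubsets {suc n} (false ∷ S) = ∈-++⁺ʳ (map (true ∷_) (allSubsets n)) (∈-map⁺ (false ∷_) (∈-allSubsets S))

  -- At most one term is nonzero. The bound `𝟙 b` in place of 1 retains what the existence of that
  -- term implies.
  ∑-allSubsets-single : ∀ {n} (p : Subset n → Bool) b Q₀ → (∀ Q → p Q ≡ true → Q ≡ Q₀) →
    (∀ Q → p Q ≡ true → b ≡ true) → ∑ (allSubsets n) (𝟙 ∘ p) ≤ 𝟙 b
  ∑-allSubsets-single {zero}  p b [] uniq imp with p [] in e
  ... | true  = ≤-reflexive (cong 𝟙 (sym (imp [] e)))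
  ... | false = z≤n
  ∑-allSubsets-single {suc n} p b (c ∷ Q₀) uniq imp = ≤-trans (≤-reflexive (∑-allSubsets n (𝟙 ∘ p))) (halves c uniq)
    where
    none : ∀ d → (∀ Q → p (d ∷ Q) ≡ true → _≡_ {A = Subset (suc n)} (d ∷ Q) (not d ∷ Q₀)) →
           ∑ (allSubsets n) (𝟙 ∘ p ∘ (d ∷_)) ≡ 0
    none d absurd = ∑-zero (allSubsets n) vanish
      where
      vanish : ∀ Q → 𝟙 (p (d ∷ Q)) ≡ 0
      vanish Q with p (d ∷ Q) in e
      ... | false = refl
      ... | true  = contradiction (cong Vec.head (absurd Q e)) (not-¬ refl)
    some : ∀ d → (∀ Q → p Q ≡ true → Q ≡ d ∷ Q₀) → ∑ (allSubsets n) (𝟙 ∘ p ∘ (d ∷_)) ≤ 𝟙 b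
    some d uniq = ∑-allSubsets-single (p ∘ (d ∷_)) b Q₀ (λ Q e → ∷-injectiveʳ (uniq (d ∷ Q) e)) (λ Q → imp (d ∷ Q))
    halves : ∀ d → (∀ Q → p Q ≡ true → Q ≡ d ∷ Q₀) →
      ∑ (allSubsets n) (𝟙 ∘ p ∘ (true ∷_)) + ∑ (allSubsets n) (𝟙 ∘ p ∘ (false ∷_)) ≤ 𝟙 b
    halves true  uniq = ≤-trans (+-mono-≤ (some true uniq) (≤-reflexive (none false (λ Q → uniq (false ∷ Q))))) (≤-reflexive (+-identityʳ (𝟙 b)))
    halves false uniq = +-mono-≤ (≤-reflexive (none true (λ Q → uniq (true ∷ Q)))) (some false uniq)

  -- Counting injective placements

  -- Coordinates in F are drawn without repetition from Q, the others without repetition from P.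
  placeᵇ : ∀ {n m} → Subset n → Subset n → Subset m → Vec (Fin n) m → Bool
  placeᵇ P Q []          []      = true
  placeᵇ P Q (false ∷ F) (x ∷ φ) = lookup P x ∧ placeᵇ (P [ x ]≔ false) Q F φ
  placeᵇ P Q (true  ∷ F) (x ∷ φ) = lookup Q x ∧ placeᵇ P (Q [ x ]≔ false) F φ

  -- With the marked set empty, every coordinate is drawn without repetition from all vertices,
  -- which is injectivity.
  injectiveᵇ : ∀ {n m} → Vec (Fin n) m → Bool
  injectiveᵇ = placeᵇ ⊤ ⊥ ⊥

  -- The product of falling factorials (p)_(m-|F|) (q)_|F|, factored in the order of the draws.
  -- Truncated subtraction is harmless, since an empty pool contributes a factor 0.
  placements : ∀ {m} → Subset m → ℕ → ℕ → ℕ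
  placements []          p q = 1
  placements (false ∷ F) p q = p * placements F (p ∸ 1) q
  placements (true  ∷ F) p q = q * placements F p (q ∸ 1)

  falling : ℕ → ℕ → ℕ
  falling n m = placements (⊥ {m}) n 0

  ∑-lookup : ∀ {n} (S : Subset n) → ∑ (allFin n) (𝟙 ∘ lookup S) ≡ ∣ S ∣
  ∑-lookup S = trans (sym (∣tabulate∣ (lookup S))) (cong ∣_∣ (tabulate∘lookup S))

  #placeᵇ : ∀ {n m} (P Q : Subset n) (F : Subset m) →
    ∑ (tuples n m) (𝟙 ∘ placeᵇ P Q F) ≡ placements F ∣ P ∣ ∣ Q ∣
  #placeᵇ P Q [] = refl
  #placeᵇ {n} {suc m} P Q (false ∷ F) = trans (∑-cartesianProductWith _∷_ (allFin n) (tuples n m) _)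
    (trans (∑-cong (allFin n) fibre)
    (trans (sym (*-distribʳ-∑ (placements F (∣ P ∣ ∸ 1) ∣ Q ∣) (allFin n) (𝟙 ∘ lookup P)))
           (cong (_* placements F (∣ P ∣ ∸ 1) ∣ Q ∣) (∑-lookup P))))
    where
    fibre : ∀ x → ∑ (tuples n m) (λ φ → 𝟙 (lookup P x ∧ placeᵇ (P [ x ]≔ false) Q F φ))
                ≡ 𝟙 (lookup P x) * placements F (∣ P ∣ ∸ 1) ∣ Q ∣
    fibre x with lookup P x in e
    ... | true  = trans (#placeᵇ (P [ x ]≔ false) Q F)
                    (trans (cong (λ p → placements F p ∣ Q ∣) (∣delete∣ P x e)) (sym (+-identityʳ _)))
    ... | false = ∑-zero (tuples n m) (λ _ → refl)
  #placeᵇ {n} {suc m} P Q (true ∷ F) = trans (∑-cartesianProductWith _∷_ (allFin n) (tuples n m) _)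
    (trans (∑-cong (allFin n) fibre)
    (trans (sym (*-distribʳ-∑ (placements F ∣ P ∣ (∣ Q ∣ ∸ 1)) (allFin n) (𝟙 ∘ lookup Q)))
           (cong (_* placements F ∣ P ∣ (∣ Q ∣ ∸ 1)) (∑-lookup Q))))
    where
    fibre : ∀ x → ∑ (tuples n m) (λ φ → 𝟙 (lookup Q x ∧ placeᵇ P (Q [ x ]≔ false) F φ))
                ≡ 𝟙 (lookup Q x) * placements F ∣ P ∣ (∣ Q ∣ ∸ 1)
    fibre x with lookup Q x in e
    ... | true  = trans (#placeᵇ P (Q [ x ]≔ false) F)
                    (trans (cong (placements F ∣ P ∣) (∣delete∣ Q x e)) (sym (+-identityʳ _)))
    ... | false = ∑-zero (tuples n m) (λ _ → refl)

  #injectiveᵇ : ∀ n m → ∑ (tuples n m) (𝟙 ∘ injectiveᵇ) ≡ falling n m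
  #injectiveᵇ n m = trans (#placeᵇ (⊤ {n}) (⊥ {n}) (⊥ {m}))
    (cong₂ (placements (⊥ {m})) (∣⊤∣≡n n) (∣⊥∣≡0 n))

  falling-zero : ∀ n m → n < m → falling n m ≡ 0
  falling-zero zero    (suc m) _         = refl
  falling-zero (suc n) (suc m) (s≤s n<m) = trans (cong (suc n *_) (falling-zero n m n<m)) (*-zeroʳ (suc n))

  -- With k = |F|, an injection amounts to the k-set onto which it carries F together with a
  -- placement around that set: (p)_(m-k) k! C(p+k, k) = (p+k)_m. A coordinate outside F is removed
  -- by `C-absorb-∸`, one inside F by `C-absorb`.
  placements*C : ∀ {m} (F : Subset m) p →
    placements F p ∣ F ∣ * ((p + ∣ F ∣) C ∣ F ∣) ≡ falling (p + ∣ F ∣) m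
  placements*C []          p = refl
  -- No vertex is left for a coordinate outside F, and correspondingly |F| ≤ m vertices admit no
  -- injection of m + 1 coordinates.
  placements*C {suc m} (false ∷ F) zero    = sym (falling-zero ∣ F ∣ (suc m) (s≤s (∣p∣≤n F)))
  placements*C {suc m} (false ∷ F) (suc p) = begin-equality
    suc p * c * ((suc p + k) C k)   ≡⟨ swap (suc p) c _ ⟩
    suc p * ((suc p + k) C k) * c   ≡⟨ cong (_* c) (C-absorb-∸ k p) ⟩
    (suc p + k) * ((p + k) C k) * c ≡⟨ assoc (suc p + k) _ c ⟩
    (suc p + k) * (c * ((p + k) C k)) ≡⟨ cong ((suc p + k) *_) (placements*C F p) ⟩
    (suc p + k) * falling (p + k) m ∎
    where
    open ≤-Reasoning
    k = ∣ F ∣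
    c = placements F p k
    swap : ∀ a b d → a * b * d ≡ a * d * b
    swap = solve-∀
    assoc : ∀ a b d → a * b * d ≡ a * (d * b)
    assoc = solve-∀
  placements*C {suc m} (true ∷ F) p = begin-equality
    suc k * c * ((p + suc k) C suc k)    ≡⟨ cong (λ N → suc k * c * (N C suc k)) (+-suc p k) ⟩
    suc k * c * (suc (p + k) C suc k)    ≡⟨ swap (suc k) c _ ⟩
    suc k * (suc (p + k) C suc k) * c    ≡⟨ cong (_* c) (C-absorb (p + k) k) ⟩
    suc (p + k) * ((p + k) C k) * c      ≡⟨ assoc (suc (p + k)) _ c ⟩
    suc (p + k) * (c * ((p + k) C k))    ≡⟨ cong (suc (p + k) *_) (placements*C F p) ⟩
    suc (p + k) * falling (p + k) m      ≡⟨ cong (λ N → falling N (suc m)) (+-suc p k) ⟨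
    falling (p + suc k) (suc m)          ∎
    where
    open ≤-Reasoning
    k = ∣ F ∣
    c = placements F p k
    swap : ∀ a b d → a * b * d ≡ a * d * b
    swap = solve-∀
    assoc : ∀ a b d → a * b * d ≡ a * (d * b)
    assoc = solve-∀

  module _ {n : ℕ} where

    delete-⊆ : ∀ (S : Subset n) x {y} → lookup (S [ x ]≔ false) y ≡ true → y ≢ x × lookup S y ≡ true
    delete-⊆ S x {y} y∈ with y ≟F x
    ... | yes refl = contradiction (trans (sym (lookup∘update x S false)) y∈) (λ ())
    ... | no  y≢x  = y≢x , trans (sym (lookup∘update′ y≢x S false)) y∈

    delete-∈ : ∀ (S : Subset n) x {y} → y ≢ x → lookup S y ≡ true → lookup (S [ x ]≔ false) y ≡ true
    delete-∈ S x y≢x y∈ = trans (lookup∘update′ y≢x S false) y∈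

    placeᵇ-∈ : ∀ {m} (P Q : Subset n) (F : Subset m) φ → placeᵇ P Q F φ ≡ true →
      ∀ i → lookup (if lookup F i then Q else P) (lookup φ i) ≡ true
    placeᵇ-∈ P Q (false ∷ F) (x ∷ φ) e zero    = proj₁ (∧-true e)
    placeᵇ-∈ P Q (true  ∷ F) (x ∷ φ) e zero    = proj₁ (∧-true e)
    placeᵇ-∈ P Q (false ∷ F) (x ∷ φ) e (suc i) with lookup F i | placeᵇ-∈ (P [ x ]≔ false) Q F φ (proj₂ (∧-true e)) i
    ... | true  | i∈ = i∈
    ... | false | i∈ = proj₂ (delete-⊆ P x i∈)
    placeᵇ-∈ P Q (true ∷ F) (x ∷ φ) e (suc i) with lookup F i | placeᵇ-∈ P (Q [ x ]≔ false) F φ (proj₂ (∧-true e)) i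
    ... | true  | i∈ = proj₂ (delete-⊆ Q x i∈)
    ... | false | i∈ = i∈

    -- Disjoint pools never yield the same vertex, so separate draws without repetition are also
    -- draws without repetition from any U containing both pools.
    placeᵇ-union : ∀ {m} (P Q U : Subset n) (F : Subset m) φ →
      (∀ y → lookup P y ≡ true → lookup U y ≡ true) → (∀ y → lookup Q y ≡ true → lookup U y ≡ true) →
      (∀ y → lookup P y ≡ true → lookup Q y ≢ true) →
      placeᵇ P Q F φ ≡ true → placeᵇ U ⊥ ⊥ φ ≡ true
    placeᵇ-union P Q U []          []      P⊆U Q⊆U disj e = refl
    placeᵇ-union P Q U (false ∷ F) (x ∷ φ) P⊆U Q⊆U disj e =
      cong₂ _∧_ (P⊆U x x∈P) (placeᵇ-union (P [ x ]≔ false) Q (U [ x ]≔ false) F φ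
        (λ y y∈ → let y≢x , y∈P = delete-⊆ P x y∈ in delete-∈ U x y≢x (P⊆U y y∈P))
        (λ y y∈ → delete-∈ U x (λ { refl → disj x x∈P y∈ }) (Q⊆U y y∈))
        (λ y y∈ → disj y (proj₂ (delete-⊆ P x y∈)))
        (proj₂ (∧-true e)))
      where x∈P = proj₁ (∧-true e)
    placeᵇ-union P Q U (true ∷ F) (x ∷ φ) P⊆U Q⊆U disj e =
      cong₂ _∧_ (Q⊆U x x∈Q) (placeᵇ-union P (Q [ x ]≔ false) (U [ x ]≔ false) F φ
        (λ y y∈ → delete-∈ U x (λ { refl → disj x y∈ x∈Q }) (P⊆U y y∈))
        (λ y y∈ → let y≢x , y∈Q = delete-⊆ Q x y∈ in delete-∈ U x y≢x (Q⊆U y y∈Q))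
        (λ y y∈ y∈′ → disj y y∈ (proj₂ (delete-⊆ Q x y∈′)))
        (proj₂ (∧-true e)))
      where x∈Q = proj₁ (∧-true e)

    placeᵇ-injective : ∀ {m} (U : Subset n) (φ : Vec (Fin n) m) → placeᵇ U ⊥ ⊥ φ ≡ true → Injective _≡_ _≡_ (lookup φ)
    placeᵇ-injective U (x ∷ φ) e {zero}  {zero}  eq = refl
    placeᵇ-injective U (x ∷ φ) e {suc i} {suc j} eq = cong suc (placeᵇ-injective (U [ x ]≔ false) φ (proj₂ (∧-true e)) eq)
    placeᵇ-injective U (x ∷ φ) e {zero}  {suc j} eq = contradiction (sym eq) (tail≢head U x φ (proj₂ (∧-true e)) j)
      where
      tail≢head : ∀ {m} (U : Subset n) x (φ : Vec (Fin n) m) → placeᵇ (U [ x ]≔ false) ⊥ ⊥ φ ≡ true → ∀ j → lookup φ j ≢ x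
      tail≢head U x φ e j = proj₁ (delete-⊆ U x (subst (λ b → lookup (if b then ⊥ else U [ x ]≔ false) (lookup φ j) ≡ true)
        (lookup-replicate j false) (placeᵇ-∈ (U [ x ]≔ false) ⊥ ⊥ φ e j)))
    placeᵇ-injective U (x ∷ φ) e {suc i} {zero}  eq = sym (placeᵇ-injective U (x ∷ φ) e (sym eq))

    injectiveᵇ-sound : ∀ {m} (φ : Vec (Fin n) m) → injectiveᵇ φ ≡ true → Injective _≡_ _≡_ (lookup φ)
    injectiveᵇ-sound = placeᵇ-injective ⊤

    -- The placement puts the image of F inside Q, and equal sizes force equality. Thus φ and F
    -- determine Q.
    place-∁ : ∀ {m} (Q : Subset n) (F : Subset m) φ → placeᵇ (∁ Q) Q F φ ≡ true → ∣ F ∣ ≡ ∣ Q ∣ →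
      injectiveᵇ φ ≡ true × Q ≡ image (lookup φ) F
    place-∁ {m} Q F φ e ∣F∣≡∣Q∣ = inj , sym (⊆∧∣≥∣⇒≡ (image (lookup φ) F) Q image⊆Q
        (≤-reflexive (trans (sym ∣F∣≡∣Q∣) (sym (∣image∣ (lookup φ) (injectiveᵇ-sound φ inj) F)))))
      where
      inj : injectiveᵇ φ ≡ true
      inj = placeᵇ-union (∁ Q) Q ⊤ F φ (λ y _ → lookup-replicate y true) (λ y _ → lookup-replicate y true)
        (λ y y∈∁Q y∈Q → contradiction (trans (sym (trans (lookup-map y not Q) (cong not y∈Q))) y∈∁Q) (λ ())) e
      image⊆Q : image (lookup φ) F ⊆ Q
      image⊆Q {w} w∈ with ∈-image⁻ (lookup φ) F w ([]=⇒lookup w∈)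
      ... | v , v∈F , refl = lookup⇒[]= (lookup φ v) Q
        (subst (λ b → lookup (if b then Q else ∁ Q) (lookup φ v) ≡ true) v∈F (placeᵇ-∈ (∁ Q) Q F φ e v))

  -- Averaging over the copies of a flag

  all-sound : ∀ {A : Set} (p : A → Bool) {xs x} → all p xs ≡ true → x ∈ xs → p x ≡ true
  all-sound p {y ∷ xs} e (here refl) = proj₁ (∧-true e)
  all-sound p {y ∷ xs} e (there i)   = all-sound p {xs} (proj₂ (∧-true e)) i

  -- If some x has p but not q, the left sum loses it and the 1 makes up for the loss; otherwise the
  -- last indicator is 1. Writing the 1 on the left avoids the subtraction in r - 1.
  pigeonhole : ∀ {A : Set} (p q : A → Bool) xs →
    ∑ xs (λ x → 𝟙 (p x ∧ q x)) + 1 ≤ ∑ xs (𝟙 ∘ p) + 𝟙 (all (λ x → not (p x) ∨ q x) xs)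
  pigeonhole p q []       = ≤-refl
  pigeonhole p q (x ∷ xs) with p x | q x
  ... | false | _     = pigeonhole p q xs
  ... | true  | true  = s≤s (pigeonhole p q xs)
  ... | true  | false = ≤-trans (≤-reflexive (+-comm _ 1)) (≤-trans (s≤s (∑-mono xs sub)) (≤-reflexive (sym (+-identityʳ _))))
    where
    sub : ∀ y → 𝟙 (p y ∧ q y) ≤ 𝟙 (p y)
    sub y with p y
    ... | true  = 𝟙≤1 (q y)
    ... | false = z≤n

  module _ {m n} (L : Hypergraph m) (G : Hypergraph n) where

    copyᵇ : Vec (Fin n) m → Bool
    copyᵇ φ = injectiveᵇ φ ∧ all (λ F → not (L F) ∨ G (image (lookup φ) F)) (allSubsets m)

    copyᵇ-sound : ∀ φ → copyᵇ φ ≡ true →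
      Injective _≡_ _≡_ (lookup φ) × (∀ F → F ∈E L → image (lookup φ) F ∈E G)
    copyᵇ-sound φ e = injectiveᵇ-sound φ (proj₁ (∧-true e)) , edges
      where
      edges : ∀ F → F ∈E L → image (lookup φ) F ∈E G
      edges F F∈L with L F | F∈L | all-sound _ (proj₂ (∧-true {injectiveᵇ φ} e)) (∈-allSubsets F)
      ... | true | _ | e′ = e′

    -- For an edge Q of G, counts pairs of an edge F of L and an injection carrying F onto Q. If L
    -- has exactly one edge of size |Q|, this is (n)_m / C(n, |Q|), the weight of Q in `h G` scaled
    -- by (n)_m.
    placedOn : Subset n → ℕ
    placedOn Q = ∑ (allSubsets m) (λ F → ∑ (tuples n m) (λ φ →
      𝟙 ((G Q ∧ (L F ∧ (∣ F ∣ ≡ᵇ ∣ Q ∣))) ∧ placeᵇ (∁ Q) Q F φ)))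

    -- The term of the single edge F is already large enough, by `placements*C` with the n - |Q|
    -- vertices outside Q as the other pool.
    falling≤placedOn : ∀ F Q → Q ∈E G → F ∈E L → ∣ Q ∣ ≡ ∣ F ∣ → falling n m ≤ placedOn Q * (n C ∣ Q ∣)
    falling≤placedOn F Q Q∈G F∈L ∣Q∣≡∣F∣ = begin
      falling n m
        ≡⟨ cong (λ N → falling N m) (m∸n+n≡m k≤n) ⟨
      falling (n ∸ k + k) m
        ≡⟨ placements*C F (n ∸ k) ⟨
      placements F (n ∸ k) k * ((n ∸ k + k) C k)
        ≡⟨ cong₂ (λ N c → c * (N C k)) (m∸n+n≡m k≤n) (sym count) ⟩
      ∑ (tuples n m) (𝟙 ∘ placeᵇ (∁ Q) Q F) * (n C k)
        ≡⟨ cong₂ (λ c j → c * (n C j)) (∑-cong (tuples n m) (λ φ → cong (λ b → 𝟙 (b ∧ placeᵇ (∁ Q) Q F φ)) (sym guard))) (sym ∣Q∣≡∣F∣) ⟩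
      ∑ (tuples n m) (λ φ → 𝟙 ((G Q ∧ (L F ∧ (∣ F ∣ ≡ᵇ ∣ Q ∣))) ∧ placeᵇ (∁ Q) Q F φ)) * (n C ∣ Q ∣)
        ≤⟨ *-monoˡ-≤ (n C ∣ Q ∣) (term≤∑ (λ F → ∑ (tuples n m) (λ φ →
             𝟙 ((G Q ∧ (L F ∧ (∣ F ∣ ≡ᵇ ∣ Q ∣))) ∧ placeᵇ (∁ Q) Q F φ))) (∈-allSubsets F)) ⟩
      placedOn Q * (n C ∣ Q ∣) ∎
      where
      open ≤-Reasoning
      k = ∣ F ∣
      k≤n : k ≤ n
      k≤n = subst (_≤ n) ∣Q∣≡∣F∣ (∣p∣≤n Q)
      count : ∑ (tuples n m) (𝟙 ∘ placeᵇ (∁ Q) Q F) ≡ placements F (n ∸ k) k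
      count = trans (#placeᵇ (∁ Q) Q F)
        (trans (cong (λ p → placements F p ∣ Q ∣) (∣∁p∣≡n∸∣p∣ Q)) (cong (λ q → placements F (n ∸ q) q) ∣Q∣≡∣F∣))
      guard : G Q ∧ (L F ∧ (∣ F ∣ ≡ᵇ ∣ Q ∣)) ≡ true
      guard rewrite Q∈G | F∈L = Equivalence.to T-≡ (≡⇒≡ᵇ ∣ F ∣ ∣ Q ∣ (sym ∣Q∣≡∣F∣))

    edgeHits : Vec (Fin n) m → ℕ
    edgeHits φ = ∑ (allSubsets m) (λ F → 𝟙 (injectiveᵇ φ ∧ (L F ∧ G (image (lookup φ) F))))

    -- After interchanging the sums, φ and F leave only one possible Q, the image of F, and it is
    -- counted only if it is an edge of G.
    ∑-placedOn : ∑ (allSubsets n) placedOn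
      ≤ ∑ (tuples n m) edgeHits
    ∑-placedOn = begin
      ∑ (allSubsets n) placedOn
        ≡⟨ ∑-cong (allSubsets n) (λ Q → ∑-comm (allSubsets m) (tuples n m) (λ F φ → 𝟙 (term φ F Q))) ⟩
      ∑ (allSubsets n) (λ Q → ∑ (tuples n m) (λ φ → ∑ (allSubsets m) (λ F → 𝟙 (term φ F Q))))
        ≡⟨ ∑-comm (allSubsets n) (tuples n m) _ ⟩
      ∑ (tuples n m) (λ φ → ∑ (allSubsets n) (λ Q → ∑ (allSubsets m) (λ F → 𝟙 (term φ F Q))))
        ≡⟨ ∑-cong (tuples n m) (λ φ → ∑-comm (allSubsets n) (allSubsets m) (λ Q F → 𝟙 (term φ F Q))) ⟩
      ∑ (tuples n m) (λ φ → ∑ (allSubsets m) (λ F → ∑ (allSubsets n) (λ Q → 𝟙 (term φ F Q))))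
        ≤⟨ ∑-mono (tuples n m) (λ φ → ∑-mono (allSubsets m) (λ F →
             ∑-allSubsets-single (term φ F) _ (image (lookup φ) F)
               (λ Q e → proj₁ (term-sound φ F Q e)) (λ Q e → proj₂ (term-sound φ F Q e)))) ⟩
      ∑ (tuples n m) edgeHits ∎
      where
      open ≤-Reasoning
      term : Vec (Fin n) m → Subset m → Subset n → Bool
      term φ F Q = (G Q ∧ (L F ∧ (∣ F ∣ ≡ᵇ ∣ Q ∣))) ∧ placeᵇ (∁ Q) Q F φ
      term-sound : ∀ φ F Q → term φ F Q ≡ true →
        Q ≡ image (lookup φ) F × injectiveᵇ φ ∧ (L F ∧ G (image (lookup φ) F)) ≡ true
      term-sound φ F Q e with ∧-true {G Q ∧ (L F ∧ (∣ F ∣ ≡ᵇ ∣ Q ∣))} e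
      ... | guard , placed with ∧-true {G Q} guard
      ... | Q∈G , guard′ with ∧-true {L F} guard′
      ... | F∈L , sizes with place-∁ Q F φ placed (≡ᵇ⇒≡ ∣ F ∣ ∣ Q ∣ (Equivalence.from T-≡ sizes))
      ... | inj , Q≡ = Q≡ , cong₂ _∧_ inj (cong₂ _∧_ F∈L (subst (λ S → G S ≡ true) Q≡ Q∈G))

    -- `pigeonhole`, applied to the edges of L and summed over all injections.
    copies-lower-bound : ∀ r → ∑ (allSubsets m) (𝟙 ∘ L) ≤ r →
      ∑ (allSubsets n) placedOn + falling n m ≤ r * falling n m + ∑ (tuples n m) (𝟙 ∘ copyᵇ)
    copies-lower-bound r e≤r = begin
      ∑ (allSubsets n) placedOn + falling n m
        ≤⟨ +-monoˡ-≤ (falling n m) ∑-placedOn ⟩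
      ∑ (tuples n m) edgeHits + falling n m
        ≡⟨ cong (∑ (tuples n m) edgeHits +_) (#injectiveᵇ n m) ⟨
      ∑ (tuples n m) edgeHits + ∑ (tuples n m) (𝟙 ∘ injectiveᵇ)
        ≡⟨ ∑-distrib-+ (tuples n m) _ _ ⟨
      ∑ (tuples n m) (λ φ → edgeHits φ + 𝟙 (injectiveᵇ φ))
        ≤⟨ ∑-mono (tuples n m) pointwise ⟩
      ∑ (tuples n m) (λ φ → r * 𝟙 (injectiveᵇ φ) + 𝟙 (copyᵇ φ))
        ≡⟨ ∑-distrib-+ (tuples n m) _ _ ⟩
      ∑ (tuples n m) (λ φ → r * 𝟙 (injectiveᵇ φ)) + ∑ (tuples n m) (𝟙 ∘ copyᵇ)
        ≡⟨ cong (_+ ∑ (tuples n m) (𝟙 ∘ copyᵇ)) (trans (sym (*-distribˡ-∑ r (tuples n m) (𝟙 ∘ injectiveᵇ))) (cong (r *_) (#injectiveᵇ n m))) ⟩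
      r * falling n m + ∑ (tuples n m) (𝟙 ∘ copyᵇ) ∎
      where
      open ≤-Reasoning
      pointwise : ∀ φ → edgeHits φ + 𝟙 (injectiveᵇ φ)
        ≤ r * 𝟙 (injectiveᵇ φ) + 𝟙 (copyᵇ φ)
      pointwise φ with injectiveᵇ φ
      ... | false = ≤-trans (≤-reflexive (trans (+-identityʳ _) (∑-zero (allSubsets m) (λ _ → refl)))) z≤n
      ... | true  = ≤-trans (pigeonhole L (λ F → G (image (lookup φ) F)) (allSubsets m))
                      (+-monoˡ-≤ _ (≤-trans e≤r (≤-reflexive (sym (*-identityʳ r)))))

  -- Blowups

  elemAt : ∀ {n} (S : Subset n) → Fin ∣ S ∣ → Fin n
  elemAt (true  ∷ S) zero    = zero
  elemAt (true  ∷ S) (suc i) = suc (elemAt S i)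
  elemAt (false ∷ S) i       = suc (elemAt S i)

  elemAt-∈ : ∀ {n} (S : Subset n) i → lookup S (elemAt S i) ≡ true
  elemAt-∈ (true  ∷ S) zero    = refl
  elemAt-∈ (true  ∷ S) (suc i) = elemAt-∈ S i
  elemAt-∈ (false ∷ S) i       = elemAt-∈ S i

  elemAt-injective : ∀ {n} (S : Subset n) {i j} → elemAt S i ≡ elemAt S j → i ≡ j
  elemAt-injective (true  ∷ S) {zero}  {zero}  e = refl
  elemAt-injective (true  ∷ S) {suc i} {suc j} e = cong suc (elemAt-injective S (suc-injective e))
  elemAt-injective (false ∷ S)                 e = elemAt-injective S (suc-injective e)

  ∈⇒0<∣∣ : ∀ {n} (S : Subset n) v → lookup S v ≡ true → 0 < ∣ S ∣
  ∈⇒0<∣∣ (true  ∷ S) v       e = s≤s z≤n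
  ∈⇒0<∣∣ (false ∷ S) (suc v) e = ∈⇒0<∣∣ S v e

  ∣∣≤1⇒unique : ∀ {n} (S : Subset n) → ∣ S ∣ ≤ 1 → ∀ v w → lookup S v ≡ true → lookup S w ≡ true → v ≡ w
  ∣∣≤1⇒unique (true  ∷ S) le       zero    zero    v∈ w∈ = refl
  ∣∣≤1⇒unique (true  ∷ S) (s≤s le) zero    (suc w) v∈ w∈ = contradiction (∈⇒0<∣∣ S w w∈) (≤⇒≯ le)
  ∣∣≤1⇒unique (true  ∷ S) (s≤s le) (suc v) w       v∈ w∈ = contradiction (∈⇒0<∣∣ S v v∈) (≤⇒≯ le)
  ∣∣≤1⇒unique (false ∷ S) le       (suc v) (suc w) v∈ w∈ = cong suc (∣∣≤1⇒unique S le v w v∈ w∈)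

  image-∘ : ∀ {a b n} (f : Fin b → Fin n) (g : Fin a → Fin b) Q → image (f ∘ g) Q ≡ image f (image g Q)
  image-∘ f g Q = subset-ext (image (f ∘ g) Q) (image f (image g Q)) forward backward
    where
    forward : ∀ w → lookup (image (f ∘ g) Q) w ≡ true → lookup (image f (image g Q)) w ≡ true
    forward w w∈ with ∈-image⁻ (f ∘ g) Q w w∈
    ... | v , v∈Q , refl = ∈-image⁺ f (image g Q) (g v) (∈-image⁺ g Q v v∈Q)
    backward : ∀ w → lookup (image f (image g Q)) w ≡ true → lookup (image (f ∘ g) Q) w ≡ true
    backward w w∈ with ∈-image⁻ f (image g Q) w w∈
    ... | u , u∈ , refl with ∈-image⁻ g Q u u∈
    ... | v , v∈Q , refl = ∈-image⁺ (f ∘ g) Q v v∈Q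

  part : ∀ {m} (s : Vec ℕ m) → Fin (sum s) → Fin m
  part s = lookup (parts s)

  part-∷ : ∀ {m} k (s : Vec ℕ m) v → part (k ∷ s) v ≡ [ const zero , suc ∘ part s ]′ (splitAt k v)
  part-∷ k s v with splitAt k v | lookup-splitAt k (Vec.replicate k zero) (Vec.map suc (parts s)) v
  ... | inj₁ a | e = trans e (lookup-replicate a zero)
  ... | inj₂ b | e = trans e (lookup-map b suc (parts s))

  module _ {m} (s : Vec ℕ m) where

    -- A transversal of the parts. Edges of the blowup are exactly the images of edges of L under
    -- sections, a form easier to use than the counts that define `blowup`.
    Section : (Fin m → Fin (sum s)) → Set
    Section p = ∀ i → part s (p i) ≡ i

    section-injective : ∀ {p} → Section p → Injective _≡_ _≡_ p
    section-injective sec {i} {j} e = trans (sym (sec i)) (trans (cong (part s) e) (sec j))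

    cell : Subset (sum s) → Fin m → Subset (sum s)
    cell Q i = Q ∩ Vec.map (λ j → ⌊ j ≟F i ⌋) (parts s)

    ∈-cell⁺ : ∀ Q i v → lookup Q v ≡ true → part s v ≡ i → lookup (cell Q i) v ≡ true
    ∈-cell⁺ Q i v v∈Q v∈i = trans (lookup-zipWith _∧_ v Q _)
      (cong₂ _∧_ v∈Q (trans (lookup-map v _ (parts s)) (trans (isYes≗does _) (dec-true (part s v ≟F i) v∈i))))

    ∈-cell⁻ : ∀ Q i v → lookup (cell Q i) v ≡ true → lookup Q v ≡ true × part s v ≡ i
    ∈-cell⁻ Q i v v∈ with ∧-true (trans (sym (lookup-zipWith _∧_ v Q (Vec.map (λ j → ⌊ j ≟F i ⌋) (parts s)))) v∈)
    ... | v∈Q , v∈i = v∈Q , toWitness (Equivalence.from T-≡ (trans (sym (lookup-map v (λ j → ⌊ j ≟F i ⌋) (parts s))) v∈i))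

  section : ∀ {m} (s : Vec ℕ m) → (∀ i → 0 < lookup s i) → ∀ i → ∃[ v ] (part s v ≡ i)
  section (zero  ∷ s) pos _       = contradiction (pos zero) (λ ())
  section (suc k ∷ s) pos zero    = zero , refl
  section (k     ∷ s) pos (suc i) with section s (pos ∘ suc) i
  ... | v , v∈i = k ↑ʳ v , trans (lookup-++ʳ (Vec.replicate k zero) (Vec.map suc (parts s)) v)
                    (trans (lookup-map v suc (parts s)) (cong suc v∈i))

  module _ {m} (L : Hypergraph m) (s : Vec ℕ m) where

    -- A section meets part i only in `p i`, so the counts per part form the indicator of F.
    blowup-edge⁺ : ∀ {p} → Section s p → ∀ F → F ∈E L → image p F ∈E blowup L s
    blowup-edge⁺ {p} sec F F∈L = cong₂ _∧_
      (trans (isYes≗does _) (dec-true (all? _) (λ i → ≤-trans (≤-reflexive (count i)) (𝟙≤1 (lookup F i)))))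
      (trans (cong L (trans (tabulate-cong trace) (tabulate∘lookup F))) F∈L)
      where
      count : ∀ i → countPart s i (image p F) ≡ 𝟙 (lookup F i)
      count i with lookup F i in e
      ... | true = trans (cong ∣_∣ (subset-ext (cell s (image p F) i) ⁅ p i ⁆ forward backward)) (∣⁅x⁆∣≡1 (p i))
        where
        forward : ∀ v → lookup (cell s (image p F) i) v ≡ true → lookup ⁅ p i ⁆ v ≡ true
        forward v v∈ with ∈-cell⁻ s (image p F) i v v∈
        ... | v∈im , v∈i with ∈-image⁻ p F v v∈im
        ... | i′ , _ , refl = subst (λ j → lookup ⁅ p i ⁆ (p j) ≡ true) (trans (sym v∈i) (sec i′)) ([]=⇒lookup (x∈⁅x⁆ (p i)))
        backward : ∀ v → lookup ⁅ p i ⁆ v ≡ true → lookup (cell s (image p F) i) v ≡ true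
        backward v v∈ with x∈⁅y⁆⇒x≡y (p i) (lookup⇒[]= v ⁅ p i ⁆ v∈)
        ... | refl = ∈-cell⁺ s (image p F) i (p i) (∈-image⁺ p F i e) (sec i)
      ... | false = trans (cong ∣_∣ (subset-ext (cell s (image p F) i) ⊥ forward
                      (λ v v∈ → contradiction (trans (sym (lookup-replicate v false)) v∈) (λ ())))) (∣⊥∣≡0 (sum s))
        where
        forward : ∀ v → lookup (cell s (image p F) i) v ≡ true → lookup ⊥ v ≡ true
        forward v v∈ with ∈-cell⁻ s (image p F) i v v∈
        ... | v∈im , v∈i with ∈-image⁻ p F v v∈im
        ... | i′ , i′∈F , refl = contradiction (trans (sym (subst (λ j → lookup F j ≡ true) (trans (sym (sec i′)) v∈i) i′∈F)) e) (λ ())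
      𝟙≡ᵇ1 : ∀ b → (𝟙 b ≡ᵇ 1) ≡ b
      𝟙≡ᵇ1 true  = refl
      𝟙≡ᵇ1 false = refl
      trace : ∀ i → (countPart s i (image p F) ≡ᵇ 1) ≡ lookup F i
      trace i = trans (cong (_≡ᵇ 1) (count i)) (𝟙≡ᵇ1 (lookup F i))

    blowup-edge⁻ : (∀ i → 0 < lookup s i) → ∀ Q → Q ∈E blowup L s →
      ∃[ p ] ∃[ F ] (Section s p × F ∈E L × Q ≡ image p F)
    blowup-edge⁻ pos Q Q∈ = p , F , sec , proj₂ (∧-true {⌊ all? (λ i → countPart s i Q ℕ.≤? 1) ⌋} Q∈)
      , subset-ext Q (image p F) forward backward
      where
      count≤1 : ∀ i → countPart s i Q ≤ 1
      count≤1 = toWitness (Equivalence.from T-≡ (proj₁ (∧-true {⌊ all? (λ i → countPart s i Q ℕ.≤? 1) ⌋} Q∈)))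
      F : Subset m
      F = Vec.tabulate (λ i → countPart s i Q ≡ᵇ 1)
      -- The section follows Q where Q meets the part. Elsewhere any vertex of the part serves as
      -- default; one exists because s_i is positive.
      choice : ∀ i → ∃[ v ] (part s v ≡ i × (0 < countPart s i Q → lookup Q v ≡ true))
      choice i with 1 ℕ.≤? countPart s i Q
      ... | yes 0<c = v , proj₂ v∈ , const (proj₁ v∈)
        where
        v = elemAt (cell s Q i) (fromℕ< 0<c)
        v∈ = ∈-cell⁻ s Q i v (elemAt-∈ (cell s Q i) (fromℕ< 0<c))
      ... | no 0≮c = proj₁ (section s pos i) , proj₂ (section s pos i) , λ 0<c → contradiction 0<c 0≮c
      p : Fin m → Fin (sum s)
      p = proj₁ ∘ choice
      sec : Section s p
      sec i = proj₁ (proj₂ (choice i))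
      forward : ∀ v → lookup Q v ≡ true → lookup (image p F) v ≡ true
      forward v v∈Q = subst (λ u → lookup (image p F) u ≡ true) p≡v (∈-image⁺ p F i i∈F)
        where
        i = part s v
        v∈cell = ∈-cell⁺ s Q i v v∈Q refl
        0<c = ∈⇒0<∣∣ (cell s Q i) v v∈cell
        i∈F : lookup F i ≡ true
        i∈F = trans (lookup∘tabulate _ i) (Equivalence.to T-≡ (≡⇒≡ᵇ (countPart s i Q) 1 (≤-antisym (count≤1 i) 0<c)))
        p≡v : p i ≡ v
        p≡v = ∣∣≤1⇒unique (cell s Q i) (count≤1 i) (p i) v (∈-cell⁺ s Q i (p i) (proj₂ (proj₂ (choice i)) 0<c) (sec i)) v∈cell
      backward : ∀ v → lookup (image p F) v ≡ true → lookup Q v ≡ true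
      backward v v∈ with ∈-image⁻ p F v v∈
      ... | i , i∈F , refl = proj₂ (proj₂ (choice i)) (≤-reflexive (sym
              (≡ᵇ⇒≡ (countPart s i Q) 1 (Equivalence.from T-≡ (trans (sym (lookup∘tabulate _ i)) i∈F)))))

  embed : ∀ {m n} (s : Vec ℕ m) (Ss : Vec (Subset n) m) → (∀ i → lookup s i ≤ ∣ lookup Ss i ∣) → Fin (sum s) → Fin n
  embed (k ∷ s) (S ∷ Ss) le v = [ (λ a → elemAt S (inject≤ a (le zero))) , embed s Ss (le ∘ suc) ]′ (splitAt k v)

  embed-∈ : ∀ {m n} (s : Vec ℕ m) (Ss : Vec (Subset n) m) le v →
    lookup (lookup Ss (part s v)) (embed s Ss le v) ≡ true
  embed-∈ (k ∷ s) (S ∷ Ss) le v with splitAt k v | part-∷ k s v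
  ... | inj₁ a | e rewrite e = elemAt-∈ S (inject≤ a (le zero))
  ... | inj₂ b | e rewrite e = embed-∈ s Ss (le ∘ suc) b

  -- Restricted to one part, since the sets in Ss may overlap; different parts are separated in
  -- `box⇒blowup`.
  embed-injective : ∀ {m n} (s : Vec ℕ m) (Ss : Vec (Subset n) m) le v w → part s v ≡ part s w →
    embed s Ss le v ≡ embed s Ss le w → v ≡ w
  embed-injective (k ∷ s) (S ∷ Ss) le v w same e =
    trans (sym (join-splitAt k (sum s) v)) (trans (cong (join k (sum s))
      (sides (splitAt k v) (splitAt k w) (trans (sym (part-∷ k s v)) (trans same (part-∷ k s w))) e))
      (join-splitAt k (sum s) w))
    where
    side : Fin k ⊎ Fin (sum s) → Fin _
    side = [ (λ a → elemAt S (inject≤ a (le zero))) , embed s Ss (le ∘ suc) ]′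
    sides : ∀ x y → [ const zero , suc ∘ part s ]′ x ≡ [ const zero , suc ∘ part s ]′ y → side x ≡ side y → x ≡ y
    sides (inj₁ a) (inj₁ b) _    e = cong inj₁ (inject≤-injective (le zero) (le zero) a b (elemAt-injective S e))
    sides (inj₂ a) (inj₂ b) same e = cong inj₂ (embed-injective s Ss (le ∘ suc) a b (suc-injective same) e)
    sides (inj₁ a) (inj₂ b) ()
    sides (inj₂ a) (inj₁ b) ()

  -- Any section followed by f is a tuple of the box, hence a copy of L. This yields the edges, each
  -- of which lies on a section, and also injectivity across parts, because copies are injective.
  box⇒blowup : ∀ {m n} (L : Hypergraph m) (G : Hypergraph n) s → (∀ i → 0 < lookup s i) →
    ContainsBox s (copyᵇ L G) → blowup L s ⊆H G
  box⇒blowup {m} {n} L G s pos (Ss , le , sound) = f , f-injective , f-edges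
    where
    f = embed s Ss le
    copy : ∀ p → Section s p → Injective _≡_ _≡_ (f ∘ p) × (∀ F → F ∈E L → image (f ∘ p) F ∈E G)
    copy p sec with copyᵇ-sound L G (Vec.tabulate (f ∘ p)) (sound _ inside)
      where
      inside : ∀ i → lookup (lookup Ss i) (lookup (Vec.tabulate (f ∘ p)) i) ≡ true
      inside i = subst₂ (λ j x → lookup (lookup Ss j) x ≡ true) (sec i) (sym (lookup∘tabulate (f ∘ p) i)) (embed-∈ s Ss le (p i))
    ... | inj , edges = (λ {i} {j} e → inj (trans (lookup∘tabulate (f ∘ p) i) (trans e (sym (lookup∘tabulate (f ∘ p) j)))))
        , λ F F∈L → subst (λ S → G S ≡ true) (image-cong (lookup∘tabulate (f ∘ p)) F) (edges F F∈L)
    f-edges : ∀ Q → Q ∈E blowup L s → image f Q ∈E G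
    f-edges Q Q∈ with blowup-edge⁻ L s pos Q Q∈
    ... | p , F , sec , F∈L , refl = subst (λ S → G S ≡ true) (image-∘ f p F) (proj₂ (copy p sec) F F∈L)
    f-injective : Injective _≡_ _≡_ f
    f-injective {v} {w} fv≡fw with part s v ≟F part s w
    ... | yes same = embed-injective s Ss le v w same fv≡fw
    ... | no  differ = ⊥-elim (differ (proj₁ (copy p sec) (trans (cong f p-v) (trans fv≡fw (cong f (sym p-w))))))
      where
      -- A section through both v and w, with arbitrary vertices in the remaining parts.
      choose : ∀ i → Dec (i ≡ part s v) → Dec (i ≡ part s w) → Fin (sum s)
      choose i (yes _) _       = v
      choose i (no _)  (yes _) = w
      choose i (no _)  (no _)  = proj₁ (section s pos i)
      p : Fin m → Fin (sum s)
      p i = choose i (i ≟F part s v) (i ≟F part s w)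
      sec : Section s p
      sec i with i ≟F part s v | i ≟F part s w
      ... | yes e | _     = sym e
      ... | no _  | yes e = sym e
      ... | no _  | no _  = proj₂ (section s pos i)
      p-v : p (part s v) ≡ v
      p-v with part s v ≟F part s v
      ... | yes _ = refl
      ... | no  n = contradiction refl n
      p-w : p (part s w) ≡ w
      p-w with part s w ≟F part s v | part s w ≟F part s w
      ... | yes e | _     = contradiction (sym e) differ
      ... | no _  | yes _ = refl
      ... | no _  | no n  = contradiction refl n

  -- Rational arithmetic

  fromℚᵘ-homo-+ : ∀ p q → fromℚᵘ (p ℚᵘ.+ q) ≡ fromℚᵘ p ℚ.+ fromℚᵘ q
  fromℚᵘ-homo-+ p q = ℚₚ.toℚᵘ-injective (begin-equality
    toℚᵘ (fromℚᵘ (p ℚᵘ.+ q))             ≃⟨ ℚₚ.toℚᵘ-fromℚᵘ (p ℚᵘ.+ q) ⟩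
    p ℚᵘ.+ q                             ≃⟨ ℚᵘₚ.+-cong (ℚₚ.toℚᵘ-fromℚᵘ p) (ℚₚ.toℚᵘ-fromℚᵘ q) ⟨
    toℚᵘ (fromℚᵘ p) ℚᵘ.+ toℚᵘ (fromℚᵘ q) ≃⟨ ℚₚ.toℚᵘ-homo-+ (fromℚᵘ p) (fromℚᵘ q) ⟨
    toℚᵘ (fromℚᵘ p ℚ.+ fromℚᵘ q)         ∎)
    where open ℚᵘₚ.≤-Reasoning

  fromℚᵘ-homo-* : ∀ p q → fromℚᵘ (p ℚᵘ.* q) ≡ fromℚᵘ p ℚ.* fromℚᵘ q
  fromℚᵘ-homo-* p q = ℚₚ.toℚᵘ-injective (begin-equality
    toℚᵘ (fromℚᵘ (p ℚᵘ.* q))             ≃⟨ ℚₚ.toℚᵘ-fromℚᵘ (p ℚᵘ.* q) ⟩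
    p ℚᵘ.* q                             ≃⟨ ℚᵘₚ.*-cong (ℚₚ.toℚᵘ-fromℚᵘ p) (ℚₚ.toℚᵘ-fromℚᵘ q) ⟨
    toℚᵘ (fromℚᵘ p) ℚᵘ.* toℚᵘ (fromℚᵘ q) ≃⟨ ℚₚ.toℚᵘ-homo-* (fromℚᵘ p) (fromℚᵘ q) ⟨
    toℚᵘ (fromℚᵘ p ℚ.* fromℚᵘ q)         ∎)
    where open ℚᵘₚ.≤-Reasoning

  ℕtoℚᵘ : ℕ → ℚᵘ
  ℕtoℚᵘ k = mkℚᵘ (ℤ.+ k) 0

  toℚ-+ : ∀ a b → toℚ (a + b) ≡ toℚ a ℚ.+ toℚ b
  toℚ-+ a b = trans (ℚₚ.fromℚᵘ-cong {ℕtoℚᵘ (a + b)} {ℕtoℚᵘ a ℚᵘ.+ ℕtoℚᵘ b}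
      (*≡* (trans (cong (ℤ._* (ℤ.1ℤ ℤ.* ℤ.1ℤ)) (ℤₚ.pos-+ a b)) (identity (ℤ.+ a) (ℤ.+ b)))))
    (fromℚᵘ-homo-+ (ℕtoℚᵘ a) (ℕtoℚᵘ b))
    where
    identity : ∀ x y → (x ℤ.+ y) ℤ.* (ℤ.1ℤ ℤ.* ℤ.1ℤ) ≡ (x ℤ.* ℤ.1ℤ ℤ.+ y ℤ.* ℤ.1ℤ) ℤ.* ℤ.1ℤ
    identity = ℤ-Solver.solve-∀

  toℚ-* : ∀ a b → toℚ (a * b) ≡ toℚ a ℚ.* toℚ b
  toℚ-* a b = trans (ℚₚ.fromℚᵘ-cong {ℕtoℚᵘ (a * b)} {ℕtoℚᵘ a ℚᵘ.* ℕtoℚᵘ b}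
      (*≡* (cong (ℤ._* (ℤ.1ℤ ℤ.* ℤ.1ℤ)) (ℤₚ.pos-* a b))))
    (fromℚᵘ-homo-* (ℕtoℚᵘ a) (ℕtoℚᵘ b))

  toℚ-mono : ∀ {a b} → a ≤ b → toℚ a ℚ.≤ toℚ b
  toℚ-mono {a} {b} a≤b = ℚₚ.toℚᵘ-cancel-≤ (begin
    toℚᵘ (toℚ a) ≃⟨ ℚₚ.toℚᵘ-fromℚᵘ (ℕtoℚᵘ a) ⟩
    ℕtoℚᵘ a      ≤⟨ *≤* (ℤₚ.*-monoʳ-≤-nonNeg ℤ.1ℤ (ℤ.+≤+ a≤b)) ⟩
    ℕtoℚᵘ b      ≃⟨ ℚₚ.toℚᵘ-fromℚᵘ (ℕtoℚᵘ b) ⟨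
    toℚᵘ (toℚ b) ∎)
    where open ℚᵘₚ.≤-Reasoning

  0≤toℚ : ∀ a → 0ℚ ℚ.≤ toℚ a
  0≤toℚ a = toℚ-mono {0} {a} z≤n

  toℚ-pos : ∀ {a} → 0 < a → ℚ.Positive (toℚ a)
  toℚ-pos {suc a} _ = ℚₚ.normalize-pos (suc a) 1

  inv-nonneg : ∀ k → 0ℚ ℚ.≤ inv k
  inv-nonneg zero    = ℚₚ.≤-refl
  inv-nonneg (suc k) = ℚₚ.nonNegative⁻¹ (inv (suc k)) {{ℚₚ.normalize-nonNeg 1 (suc k)}}

  inv-* : ∀ k → 0 < k → inv k ℚ.* toℚ k ≡ 1ℚ
  inv-* (suc k) _ = trans (sym (fromℚᵘ-homo-* (mkℚᵘ (ℤ.+ 1) k) (ℕtoℚᵘ (suc k))))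
    (ℚₚ.fromℚᵘ-cong {mkℚᵘ (ℤ.+ 1) k ℚᵘ.* ℕtoℚᵘ (suc k)} {ℕtoℚᵘ 1} (*≡* (identity (ℤ.+ suc k))))
    where
    identity : ∀ x → (ℤ.+ 1 ℤ.* x) ℤ.* ℤ.1ℤ ≡ ℤ.1ℤ ℤ.* (x ℤ.* ℤ.1ℤ)
    identity = ℤ-Solver.solve-∀

  ℚ-*-monoʳ : ∀ {p q} r → 0ℚ ℚ.≤ r → p ℚ.≤ q → p ℚ.* r ℚ.≤ q ℚ.* r
  ℚ-*-monoʳ r 0≤r = ℚₚ.*-monoʳ-≤-nonNeg r {{ℚ.nonNegative 0≤r}}

  ℚ-*-monoˡ : ∀ {p q} r → 0ℚ ℚ.≤ r → p ℚ.≤ q → r ℚ.* p ℚ.≤ r ℚ.* q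
  ℚ-*-monoˡ r 0≤r = ℚₚ.*-monoˡ-≤-nonNeg r {{ℚ.nonNegative 0≤r}}

  0≤* : ∀ {p q} → 0ℚ ℚ.≤ p → 0ℚ ℚ.≤ q → 0ℚ ℚ.≤ p ℚ.* q
  0≤* {p} {q} 0≤p 0≤q = subst (ℚ._≤ p ℚ.* q) (ℚₚ.*-zeroˡ q) (ℚ-*-monoʳ q 0≤q 0≤p)

  0≤^ℚ : ∀ {q} k → 0ℚ ℚ.≤ q → 0ℚ ℚ.≤ q ^ℚ k
  0≤^ℚ zero    0≤q = toℚ-mono {0} {1} z≤n
  0≤^ℚ (suc k) 0≤q = 0≤* 0≤q (0≤^ℚ k 0≤q)

  ^ℚ-mono : ∀ {p q} k → 0ℚ ℚ.≤ p → p ℚ.≤ q → p ^ℚ k ℚ.≤ q ^ℚ k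
  ^ℚ-mono zero    0≤p p≤q = ℚₚ.≤-refl
  ^ℚ-mono {p} {q} (suc k) 0≤p p≤q = ℚₚ.≤-trans (ℚ-*-monoˡ p 0≤p (^ℚ-mono k 0≤p p≤q))
    (ℚ-*-monoʳ (q ^ℚ k) (0≤^ℚ k (ℚₚ.≤-trans 0≤p p≤q)) p≤q)

  ℚ-*-interchange : ∀ a b c d → (a ℚ.* b) ℚ.* (c ℚ.* d) ≡ (a ℚ.* c) ℚ.* (b ℚ.* d)
  ℚ-*-interchange = solve 4 (λ a b c d → (a :* b) :* (c :* d) := (a :* c) :* (b :* d)) refl
    where open +-*-Solver

  ^ℚ-distrib-* : ∀ k p q → (p ℚ.* q) ^ℚ k ≡ (p ^ℚ k) ℚ.* (q ^ℚ k)
  ^ℚ-distrib-* zero    p q = refl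
  ^ℚ-distrib-* (suc k) p q = trans (cong (p ℚ.* q ℚ.*_) (^ℚ-distrib-* k p q)) (ℚ-*-interchange p q (p ^ℚ k) (q ^ℚ k))

  ^ℚ-+ : ∀ q a b → q ^ℚ (a + b) ≡ (q ^ℚ a) ℚ.* (q ^ℚ b)
  ^ℚ-+ q zero    b = sym (ℚₚ.*-identityˡ _)
  ^ℚ-+ q (suc a) b = trans (cong (q ℚ.*_) (^ℚ-+ q a b)) (sym (ℚₚ.*-assoc q (q ^ℚ a) (q ^ℚ b)))

  ^ℚ-* : ∀ q a b → q ^ℚ (a * b) ≡ (q ^ℚ b) ^ℚ a
  ^ℚ-* q zero    b = refl
  ^ℚ-* q (suc a) b = trans (^ℚ-+ q b (a * b)) (cong ((q ^ℚ b) ℚ.*_) (^ℚ-* q a b))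

  toℚ-^ : ∀ a k → toℚ (a ^ k) ≡ toℚ a ^ℚ k
  toℚ-^ a zero    = refl
  toℚ-^ a (suc k) = trans (toℚ-* a (a ^ k)) (cong (toℚ a ℚ.*_) (toℚ-^ a k))

  ∑ℚ : {A : Set} → List A → (A → ℚ) → ℚ
  ∑ℚ xs g = foldr ℚ._+_ 0ℚ (map g xs)

  module _ {A : Set} where

    ∑ℚ-mono : ∀ (xs : List A) {f g} → (∀ x → f x ℚ.≤ g x) → ∑ℚ xs f ℚ.≤ ∑ℚ xs g
    ∑ℚ-mono []       le = ℚₚ.≤-refl
    ∑ℚ-mono (x ∷ xs) le = ℚₚ.+-mono-≤ (le x) (∑ℚ-mono xs le)

    ∑ℚ-cong : ∀ (xs : List A) {f g} → (∀ x → f x ≡ g x) → ∑ℚ xs f ≡ ∑ℚ xs g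
    ∑ℚ-cong []       e = refl
    ∑ℚ-cong (x ∷ xs) e = cong₂ ℚ._+_ (e x) (∑ℚ-cong xs e)

    ∑ℚ-nonneg : ∀ (xs : List A) {g} → (∀ x → 0ℚ ℚ.≤ g x) → 0ℚ ℚ.≤ ∑ℚ xs g
    ∑ℚ-nonneg []       le = ℚₚ.≤-refl
    ∑ℚ-nonneg (x ∷ xs) le = ℚₚ.+-mono-≤ (le x) (∑ℚ-nonneg xs le)

    ∑ℚ-+ : ∀ (xs : List A) f g → ∑ℚ xs (λ x → f x ℚ.+ g x) ≡ ∑ℚ xs f ℚ.+ ∑ℚ xs g
    ∑ℚ-+ []       f g = refl
    ∑ℚ-+ (x ∷ xs) f g = trans (cong (f x ℚ.+ g x ℚ.+_) (∑ℚ-+ xs f g)) (interchange (f x) (g x) (∑ℚ xs f) (∑ℚ xs g))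
      where
      open +-*-Solver
      interchange : ∀ a b c d → (a ℚ.+ b) ℚ.+ (c ℚ.+ d) ≡ (a ℚ.+ c) ℚ.+ (b ℚ.+ d)
      interchange = solve 4 (λ a b c d → (a :+ b) :+ (c :+ d) := (a :+ c) :+ (b :+ d)) refl

    -- The passage from the rational weights in `h` to integer counts; q will be the number of
    -- injections.
    ∑ℚ-scaled-≤ : ∀ (xs : List A) f (w : A → ℕ) q → (∀ x → f x ℚ.* q ℚ.≤ toℚ (w x)) → ∑ℚ xs f ℚ.* q ℚ.≤ toℚ (∑ xs w)
    ∑ℚ-scaled-≤ []       f w q le = ℚₚ.≤-reflexive (ℚₚ.*-zeroˡ q)
    ∑ℚ-scaled-≤ (x ∷ xs) f w q le = begin
      (f x ℚ.+ ∑ℚ xs f) ℚ.* q          ≡⟨ ℚₚ.*-distribʳ-+ q (f x) (∑ℚ xs f) ⟩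
      f x ℚ.* q ℚ.+ ∑ℚ xs f ℚ.* q      ≤⟨ ℚₚ.+-mono-≤ (le x) (∑ℚ-scaled-≤ xs f w q le) ⟩
      toℚ (w x) ℚ.+ toℚ (∑ xs w)       ≡⟨ toℚ-+ (w x) (∑ xs w) ⟨
      toℚ (w x + ∑ xs w)               ∎
      where open ℚₚ.≤-Reasoning

    ∑ℚ-indicator : ∀ (xs : List A) p q → ∑ℚ xs (λ x → if p x then q else 0ℚ) ≡ toℚ (∑ xs (𝟙 ∘ p)) ℚ.* q
    ∑ℚ-indicator []       p q = sym (ℚₚ.*-zeroˡ q)
    ∑ℚ-indicator (x ∷ xs) p q with p x
    ... | true  = begin-equality
      q ℚ.+ ∑ℚ xs (λ x → if p x then q else 0ℚ)  ≡⟨ cong₂ ℚ._+_ (sym (ℚₚ.*-identityˡ q)) (∑ℚ-indicator xs p q) ⟩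
      1ℚ ℚ.* q ℚ.+ toℚ (∑ xs (𝟙 ∘ p)) ℚ.* q      ≡⟨ ℚₚ.*-distribʳ-+ q 1ℚ (toℚ (∑ xs (𝟙 ∘ p))) ⟨
      (1ℚ ℚ.+ toℚ (∑ xs (𝟙 ∘ p))) ℚ.* q          ≡⟨ cong (ℚ._* q) (toℚ-+ 1 (∑ xs (𝟙 ∘ p))) ⟨
      toℚ (1 + ∑ xs (𝟙 ∘ p)) ℚ.* q               ∎
      where open ℚₚ.≤-Reasoning
    ... | false = trans (ℚₚ.+-identityˡ _) (∑ℚ-indicator xs p q)

  p+q-p≡q : ∀ a b → (a ℚ.+ b) ℚ.- a ≡ b
  p+q-p≡q = solve 2 (λ a b → (a :+ b) :- a := b) refl
    where open +-*-Solver

  -- Extremal hypergraphs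

  allSubset? : ∀ {n} {P : Subset n → Set} → (∀ S → Dec (P S)) → Dec (∀ S → P S)
  allSubset? P? = map′ (λ none S → decidable-stable (P? S) (λ ¬p → none (S , ¬p)))
                       (λ all (S , ¬p) → ¬p (all S)) (¬? (anySubset? (¬? ∘ P?)))

  anyTuple? : ∀ {n k} {P : Vec (Fin n) k → Set} → (∀ φ → Dec (P φ)) → Dec (∃[ φ ] P φ)
  anyTuple? {k = zero}  P? = map′ (λ p → [] , p) (λ { ([] , p) → p }) (P? [])
  anyTuple? {k = suc k} P? = map′ (λ (x , φ , p) → x ∷ φ , p) (λ { (x ∷ φ , p) → x , φ , p })
                                  (any? (λ x → anyTuple? (P? ∘ (x ∷_))))

  -- The search runs over tuples, which can be enumerated; `image-cong` makes the passage between a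
  -- function and its tabulation harmless.
  _⊆H?_ : ∀ {a n} (H : Hypergraph a) (G : Hypergraph n) → Dec (H ⊆H G)
  _⊆H?_ {a} {n} H G = map′ to from (anyTuple? copy?)
    where
    Copy : (Fin a → Fin n) → Set
    Copy f = (∀ i j → f i ≡ f j → i ≡ j) × (∀ F → F ∈E H → image f F ∈E G)
    copy? : ∀ φ → Dec (Copy (lookup φ))
    copy? φ = all? (λ i → all? (λ j → (lookup φ i ≟F lookup φ j) →-dec (i ≟F j)))
      ×-dec allSubset? (λ F → (H F ≟B true) →-dec (G (image (lookup φ) F) ≟B true))
    to : (∃[ φ ] Copy (lookup φ)) → H ⊆H G
    to (φ , inj , edges) = lookup φ , (λ {i} {j} → inj i j) , edges
    from : H ⊆H G → ∃[ φ ] Copy (lookup φ)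
    from (f , inj , edges) = Vec.tabulate f
      , (λ i j e → inj (trans (sym (lookup∘tabulate f i)) (trans e (lookup∘tabulate f j))))
      , λ F F∈H → trans (cong G (image-cong (lookup∘tabulate f) F)) (edges F F∈H)

  admissible? : ∀ {a n} (H : Hypergraph a) (G : Hypergraph n) → Dec (Admissible H n G)
  admissible? H G = allSubset? (λ F → (G F ≟B true) →-dec anySubset? (λ F′ → (H F′ ≟B true) ×-dec (∣ F ∣ ℕ.≟ ∣ F′ ∣)))
    ×-dec ¬? (H ⊆H? G)

  Admissible-resp : ∀ {a n} (H : Hypergraph a) {G G′ : Hypergraph n} → (∀ F → G F ≡ G′ F) →
    Admissible H n G → Admissible H n G′
  Admissible-resp H G≗G′ (sizes , free) = (λ F F∈G′ → sizes F (trans (G≗G′ F) F∈G′))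
    , λ (f , inj , edges) → free (f , inj , λ F F∈H → trans (G≗G′ (image f F)) (edges F F∈H))

  h-cong : ∀ {n} {G G′ : Hypergraph n} → (∀ F → G F ≡ G′ F) → h G ≡ h G′
  h-cong {n} G≗G′ = ∑ℚ-cong (allSubsets n) (λ F → cong (λ b → if b then inv (n C ∣ F ∣) else 0ℚ) (G≗G′ F))

  branch : ∀ {n} → Hypergraph n → Hypergraph n → Hypergraph (suc n)
  branch G₁ G₂ (true  ∷ F) = G₁ F
  branch G₁ G₂ (false ∷ F) = G₂ F

  hypergraphs : ∀ n → List (Hypergraph n)
  hypergraphs zero    = (λ _ → true) ∷ (λ _ → false) ∷ []
  hypergraphs (suc n) = cartesianProductWith branch (hypergraphs n) (hypergraphs n)

  -- Hypergraphs are functions, so the list is complete only up to pointwise equality. Both `h` and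
  -- admissibility respect that equality, so this suffices for the maximum.
  hypergraphs-complete : ∀ {n} (G : Hypergraph n) → ∃[ G′ ] (G′ ∈ hypergraphs n × (∀ F → G F ≡ G′ F))
  hypergraphs-complete {zero} G with G [] in e
  ... | true  = (λ _ → true) , here refl , λ { [] → e }
  ... | false = (λ _ → false) , there (here refl) , λ { [] → e }
  hypergraphs-complete {suc n} G with hypergraphs-complete (G ∘ (true ∷_)) | hypergraphs-complete (G ∘ (false ∷_))
  ... | G₁ , G₁∈ , e₁ | G₂ , G₂∈ , e₂ = branch G₁ G₂ , ∈-cartesianProductWith⁺ branch G₁∈ G₂∈ ,
        λ { (true ∷ F) → e₁ F ; (false ∷ F) → e₂ F }

  argmax : ∀ {A : Set} {P : A → Set} (P? : ∀ x → Dec (P x)) (f : A → ℚ) xs y → P y →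
    ∃[ z ] (P z × f y ℚ.≤ f z × (∀ w → w ∈ xs → P w → f w ℚ.≤ f z))
  argmax P? f []       y py = y , py , ℚₚ.≤-refl , λ _ ()
  argmax P? f (w ∷ xs) y py with argmax P? f xs y py
  ... | z , pz , y≤z , max with P? w | ℚₚ.≤-total (f w) (f z)
  ... | yes pw | inj₂ z≤w = w , pw , ℚₚ.≤-trans y≤z z≤w ,
        λ { _ (here refl) _ → ℚₚ.≤-refl ; v (there i) pv → ℚₚ.≤-trans (max v i pv) z≤w }
  ... | yes pw | inj₁ w≤z = z , pz , y≤z , λ { _ (here refl) _ → w≤z ; v (there i) pv → max v i pv }
  ... | no ¬pw | _        = z , pz , y≤z , λ { _ (here refl) pw → contradiction pw ¬pw ; v (there i) pv → max v i pv }

  ∃-IsPi : ∀ {a n} (H : Hypergraph a) (G : Hypergraph n) → Admissible H n G → ∃[ x ] IsPi H n x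
  ∃-IsPi {n = n} H G adm with argmax (admissible? H) h (hypergraphs n) G adm
  ... | M , admM , _ , max = h M , (M , admM , refl) , bound
    where
    bound : ∀ G′ → Admissible H n G′ → h G′ ℚ.≤ h M
    bound G′ adm′ with hypergraphs-complete G′
    ... | G₁ , G₁∈ , e = ℚₚ.≤-trans (ℚₚ.≤-reflexive (h-cong e)) (max G₁ G₁∈ (Admissible-resp H e adm′))

  -- Complete hypergraphs on all sizes but one

  withSizes : List ℕ → ∀ {n} → Hypergraph n
  withSizes R F = ⌊ ∣ F ∣ ∈? R ⌋

  ∈-withSizes⁻ : ∀ R {n} (F : Subset n) → F ∈E withSizes R → ∣ F ∣ ∈ R
  ∈-withSizes⁻ R F e = toWitness (Equivalence.from T-≡ e)

  ∈-withSizes⁺ : ∀ R {n} (F : Subset n) → ∣ F ∣ ∈ R → F ∈E withSizes R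
  ∈-withSizes⁺ R F e = trans (isYes≗does _) (dec-true (∣ F ∣ ∈? R) e)

  -- A size k ≤ n contributes C(n, k) sets of weight 1/C(n, k), in total 1. Distinctness of the
  -- sizes keeps the layers disjoint.
  h-withSizes : ∀ n R → Unique R → All (_≤ n) R → toℚ (length R) ℚ.≤ h (withSizes R {n})
  h-withSizes n [] _ _ = ∑ℚ-nonneg (allSubsets n) (λ _ → ℚₚ.≤-refl)
  h-withSizes n (k ∷ R) (k∉R ∷ uniq) (k≤n ∷ R≤n) = begin
    toℚ (suc (length R))
      ≡⟨ toℚ-+ 1 (length R) ⟩
    1ℚ ℚ.+ toℚ (length R)
      ≤⟨ ℚₚ.+-mono-≤ (ℚₚ.≤-reflexive layer) (h-withSizes n R uniq R≤n) ⟩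
    ∑ℚ (allSubsets n) (λ F → if ∣ F ∣ ≡ᵇ k then inv (n C k) else 0ℚ) ℚ.+ h (withSizes R {n})
      ≡⟨ ∑ℚ-+ (allSubsets n) _ _ ⟨
    ∑ℚ (allSubsets n) (λ F → (if ∣ F ∣ ≡ᵇ k then inv (n C k) else 0ℚ) ℚ.+ (if withSizes R F then inv (n C ∣ F ∣) else 0ℚ))
      ≤⟨ ∑ℚ-mono (allSubsets n) pointwise ⟩
    h (withSizes (k ∷ R) {n}) ∎
    where
    open ℚₚ.≤-Reasoning
    layer : 1ℚ ≡ ∑ℚ (allSubsets n) (λ F → if ∣ F ∣ ≡ᵇ k then inv (n C k) else 0ℚ)
    layer = sym (trans (∑ℚ-indicator (allSubsets n) (λ F → ∣ F ∣ ≡ᵇ k) (inv (n C k)))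
      (trans (cong (λ c → toℚ c ℚ.* inv (n C k)) (#subsets n k))
      (trans (ℚₚ.*-comm (toℚ (n C k)) (inv (n C k))) (inv-* (n C k) (C-pos n k k≤n)))))
    -- The Booleans stand for size equal to k, size in R and size in `k ∷ R`; the first two exclude
    -- each other.
    combine : ∀ a b c {x y} → (a ≡ true → x ≡ y) → (a ≡ true → b ≡ false) → (a ≡ true → c ≡ true) → (b ≡ true → c ≡ true) →
      0ℚ ℚ.≤ y → (if a then x else 0ℚ) ℚ.+ (if b then y else 0ℚ) ℚ.≤ (if c then y else 0ℚ)
    combine true  b c x≡y a⇒¬b a⇒c b⇒c 0≤y rewrite x≡y refl | a⇒¬b refl | a⇒c refl = ℚₚ.≤-reflexive (ℚₚ.+-identityʳ _)
    combine false true c x≡y a⇒¬b a⇒c b⇒c 0≤y rewrite b⇒c refl = ℚₚ.≤-reflexive (ℚₚ.+-identityˡ _)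
    combine false false true  x≡y a⇒¬b a⇒c b⇒c 0≤y = 0≤y
    combine false false false x≡y a⇒¬b a⇒c b⇒c 0≤y = ℚₚ.≤-refl
    pointwise : ∀ F → (if ∣ F ∣ ≡ᵇ k then inv (n C k) else 0ℚ) ℚ.+ (if withSizes R F then inv (n C ∣ F ∣) else 0ℚ)
      ℚ.≤ (if withSizes (k ∷ R) F then inv (n C ∣ F ∣) else 0ℚ)
    pointwise F = combine (∣ F ∣ ≡ᵇ k) (withSizes R F) (withSizes (k ∷ R) F)
      (λ e → cong (λ j → inv (n C j)) (sym (size e)))
      (λ e → ¬true (λ F∈ → All.lookup k∉R (∈-withSizes⁻ R F F∈) (sym (size e))))
      (λ e → ∈-withSizes⁺ (k ∷ R) F (here (size e)))
      (λ F∈ → ∈-withSizes⁺ (k ∷ R) F (there (∈-withSizes⁻ R F F∈)))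
      (inv-nonneg (n C ∣ F ∣))
      where
      size : (∣ F ∣ ≡ᵇ k) ≡ true → ∣ F ∣ ≡ k
      size e = ≡ᵇ⇒≡ ∣ F ∣ k (Equivalence.from T-≡ e)
      ¬true : ∀ {b} → b ≢ true → b ≡ false
      ¬true {true}  n = contradiction refl n
      ¬true {false} n = refl

  -- The density of a hypergraph and its copies of the flag

  module _ {R m} {L : Hypergraph m} (flag : IsFlag R L) (s : Vec ℕ m) (pos : ∀ i → 0 < lookup s i) where

    blowup-size : ∀ {k} → k ∈ R → ∃[ Q ] (Q ∈E blowup L s × ∣ Q ∣ ≡ k)
    blowup-size {k} k∈R with proj₁ flag k k∈R
    ... | F , F∈L , ∣F∣≡k , _ = image p F , blowup-edge⁺ L s sec F F∈L , trans (∣image∣ p (section-injective s sec) F) ∣F∣≡k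
      where
      p = proj₁ ∘ section s pos
      sec = proj₂ ∘ section s pos

    h*falling≤ : ∀ {n} (G : Hypergraph n) → SizesIn G (blowup L s) →
      h G ℚ.* toℚ (falling n m) ℚ.≤ toℚ (∑ (allSubsets n) (placedOn L G))
    h*falling≤ {n} G sizes = ∑ℚ-scaled-≤ (allSubsets n) _ (placedOn L G) (toℚ (falling n m)) pointwise
      where
      open ℚₚ.≤-Reasoning
      weight : ∀ Q b → G Q ≡ b → (if b then inv (n C ∣ Q ∣) else 0ℚ) ℚ.* toℚ (falling n m) ℚ.≤ toℚ (placedOn L G Q)
      weight Q false _   = ℚₚ.≤-trans (ℚₚ.≤-reflexive (ℚₚ.*-zeroˡ (toℚ (falling n m)))) (0≤toℚ (placedOn L G Q))
      weight Q true  Q∈G with sizes Q Q∈G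
      ... | Q′ , Q′∈ , ∣Q∣≡∣Q′∣ with blowup-edge⁻ L s pos Q′ Q′∈
      ... | p , F , sec , F∈L , Q′≡ = begin
        inv c ℚ.* toℚ (falling n m)               ≤⟨ ℚ-*-monoˡ (inv c) (inv-nonneg c) (toℚ-mono (falling≤placedOn L G F Q Q∈G F∈L ∣Q∣≡∣F∣)) ⟩
        inv c ℚ.* toℚ (placedOn L G Q * c)        ≡⟨ cong (inv c ℚ.*_) (trans (cong toℚ (*-comm (placedOn L G Q) c)) (toℚ-* c (placedOn L G Q))) ⟩
        inv c ℚ.* (toℚ c ℚ.* toℚ (placedOn L G Q)) ≡⟨ ℚₚ.*-assoc (inv c) (toℚ c) (toℚ (placedOn L G Q)) ⟨
        (inv c ℚ.* toℚ c) ℚ.* toℚ (placedOn L G Q) ≡⟨ cong (ℚ._* toℚ (placedOn L G Q)) (inv-* c (C-pos n ∣ Q ∣ (∣p∣≤n Q))) ⟩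
        1ℚ ℚ.* toℚ (placedOn L G Q)               ≡⟨ ℚₚ.*-identityˡ (toℚ (placedOn L G Q)) ⟩
        toℚ (placedOn L G Q)                      ∎
        where
        c = n C ∣ Q ∣
        ∣Q∣≡∣F∣ : ∣ Q ∣ ≡ ∣ F ∣
        ∣Q∣≡∣F∣ = trans ∣Q∣≡∣Q′∣ (trans (cong ∣_∣ Q′≡) (∣image∣ p (section-injective s sec) F))
      pointwise : ∀ Q → (if G Q then inv (n C ∣ Q ∣) else 0ℚ) ℚ.* toℚ (falling n m) ℚ.≤ toℚ (placedOn L G Q)
      pointwise Q = weight Q (G Q) refl

    -- Sorted by size, the edges of a flag fall into classes indexed by R with at most one edge in
    -- each.
    edges≤ : ∑ (allSubsets m) (𝟙 ∘ L) ≤ length R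
    edges≤ = begin
      ∑ (allSubsets m) (𝟙 ∘ L)
        ≤⟨ ∑-mono (allSubsets m) has-size ⟩
      ∑ (allSubsets m) (λ F → ∑ R (λ k → 𝟙 (L F ∧ (∣ F ∣ ≡ᵇ k))))
        ≡⟨ ∑-comm (allSubsets m) R _ ⟩
      ∑ R (λ k → ∑ (allSubsets m) (λ F → 𝟙 (L F ∧ (∣ F ∣ ≡ᵇ k))))
        ≤⟨ ∑-mono-∈ R single ⟩
      ∑ R (λ _ → 1)
        ≡⟨ trans (∑-const R 1) (*-identityʳ (length R)) ⟩
      length R ∎
      where
      open ≤-Reasoning
      has-size : ∀ F → 𝟙 (L F) ≤ ∑ R (λ k → 𝟙 (L F ∧ (∣ F ∣ ≡ᵇ k)))
      has-size F with L F in F∈L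
      ... | false = z≤n
      ... | true  = subst (_≤ ∑ R (λ k → 𝟙 (∣ F ∣ ≡ᵇ k))) (cong 𝟙 (Equivalence.to T-≡ (≡⇒≡ᵇ ∣ F ∣ ∣ F ∣ refl)))
                      (term≤∑ (λ k → 𝟙 (∣ F ∣ ≡ᵇ k)) (proj₂ flag F F∈L))
      single : ∀ k → k ∈ R → ∑ (allSubsets m) (λ F → 𝟙 (L F ∧ (∣ F ∣ ≡ᵇ k))) ≤ 1
      single k k∈R with proj₁ flag k k∈R
      ... | F₀ , _ , _ , only = ∑-allSubsets-single (λ F → L F ∧ (∣ F ∣ ≡ᵇ k)) true F₀
            (λ F e → let F∈L , size = ∧-true e in only F F∈L (≡ᵇ⇒≡ ∣ F ∣ k (Equivalence.from T-≡ size)))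
            (λ _ _ → refl)

    excess≤copies : ∀ {n} (G : Hypergraph n) → SizesIn G (blowup L s) →
      (h G ℚ.- (toℚ (length R) ℚ.- 1ℚ)) ℚ.* toℚ (falling n m) ℚ.≤ toℚ (∑ (tuples n m) (𝟙 ∘ copyᵇ L G))
    excess≤copies {n} G sizes = begin
      (h G ℚ.- (r ℚ.- 1ℚ)) ℚ.* f
        ≡⟨ expand (h G) r f ⟩
      (h G ℚ.* f ℚ.+ f) ℚ.- r ℚ.* f
        ≤⟨ ℚₚ.+-monoˡ-≤ (ℚ.- (r ℚ.* f)) bound ⟩
      (r ℚ.* f ℚ.+ toℚ N) ℚ.- r ℚ.* f
        ≡⟨ p+q-p≡q (r ℚ.* f) (toℚ N) ⟩
      toℚ N ∎
      where
      open ℚₚ.≤-Reasoning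
      open +-*-Solver
      r = toℚ (length R)
      f = toℚ (falling n m)
      N = ∑ (tuples n m) (𝟙 ∘ copyᵇ L G)
      S = ∑ (allSubsets n) (placedOn L G)
      expand : ∀ x r f → (x ℚ.- (r ℚ.- 1ℚ)) ℚ.* f ≡ (x ℚ.* f ℚ.+ f) ℚ.- r ℚ.* f
      expand = solve 3 (λ x r f → (x :- (r :- con 1ℚ)) :* f := (x :* f :+ f) :- r :* f) refl
      bound : h G ℚ.* f ℚ.+ f ℚ.≤ r ℚ.* f ℚ.+ toℚ N
      bound = begin
        h G ℚ.* f ℚ.+ f                     ≤⟨ ℚₚ.+-monoˡ-≤ f (h*falling≤ G sizes) ⟩
        toℚ S ℚ.+ f                         ≡⟨ toℚ-+ S (falling n m) ⟨
        toℚ (S + falling n m)               ≤⟨ toℚ-mono (copies-lower-bound L G (length R) edges≤) ⟩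
        toℚ (length R * falling n m + N)    ≡⟨ toℚ-+ (length R * falling n m) N ⟩
        toℚ (length R * falling n m) ℚ.+ toℚ N ≡⟨ cong (ℚ._+ toℚ N) (toℚ-* (length R) (falling n m)) ⟩
        r ℚ.* f ℚ.+ toℚ N                   ∎

  -- The blowup has an edge of the omitted size k, and injections preserve sizes.
  withSizes-admissible : ∀ {k R m} {L : Hypergraph m} → IsFlag (k ∷ R) L → Unique (k ∷ R) →
    ∀ s → (∀ i → 0 < lookup s i) → ∀ n → Admissible (blowup L s) n (withSizes R)
  withSizes-admissible {k} {R} {L = L} flag (k∉R ∷ _) s pos n = sizes , free
    where
    sizes : SizesIn (withSizes R {n}) (blowup L s)
    sizes F F∈ with blowup-size flag s pos (there (∈-withSizes⁻ R F F∈))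
    ... | Q , Q∈ , ∣Q∣≡ = Q , Q∈ , sym ∣Q∣≡
    free : ¬ (blowup L s ⊆H withSizes R {n})
    free (f , inj , edges) with blowup-size flag s pos (here refl)
    ... | Q , Q∈ , ∣Q∣≡k = All.lookup k∉R (subst (_∈ R) (trans (∣image∣ f inj Q) ∣Q∣≡k) (∈-withSizes⁻ R (image f Q) (edges Q Q∈))) refl

  -- The excess of the density over r − 1

  -- For n ≥ 2m each of the m factors of (n)_m is at least n/2.
  ^≤falling : ∀ n m → 2 * m ≤ n → n ^ m ≤ 2 ^ m * falling n m
  ^≤falling n m 2m≤n = go n m (begin
    n               ≤⟨ m+n≤o⇒m≤o∸n n (+-monoʳ-≤ n (≤-trans 2m≤n (≤-reflexive (sym (+-identityʳ n))))) ⟩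
    2 * n ∸ 2 * m   ≡⟨ *-distribˡ-∸ 2 n m ⟨
    2 * (n ∸ m)     ∎)
    where
    open ≤-Reasoning
    -- N descends through the factors while n stays fixed; the hypothesis is invariant when N and m
    -- drop together.
    go : ∀ N m → n ≤ 2 * (N ∸ m) → n ^ m ≤ 2 ^ m * falling N m
    go N zero    _  = ≤-refl
    go N (suc m) le = begin
      n * n ^ m                                ≤⟨ *-mono-≤ (≤-trans le (*-monoʳ-≤ 2 (m∸n≤m N (suc m))))
                                                    (go (N ∸ 1) m (≤-trans le (≤-reflexive (cong (2 *_) (sym (∸-+-assoc N 1 m)))))) ⟩
      2 * N * (2 ^ m * falling (N ∸ 1) m)      ≡⟨ interchange 2 N (2 ^ m) (falling (N ∸ 1) m) ⟩
      2 ^ suc m * falling N (suc m)            ∎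
      where
      interchange : ∀ a b c d → a * b * (c * d) ≡ a * c * (b * d)
      interchange = solve-∀

  ∃-maxV : ∀ {m} (s : Vec ℕ (suc m)) → ∃[ j ] (lookup s j ≡ maxV s)
  ∃-maxV (a ∷ []) = zero , sym (⊔-identityʳ a)
  ∃-maxV (a ∷ s@(_ ∷ _)) with ∃-maxV s | ≤-total a (maxV s)
  ... | j , e | inj₁ a≤ = suc j , trans e (sym (m≤n⇒m⊔n≡n a≤))
  ... | j , e | inj₂ ≤a = zero , sym (m≥n⇒m⊔n≡m ≤a)

  lookup≤maxV : ∀ {m} (s : Vec ℕ m) i → lookup s i ≤ maxV s
  lookup≤maxV (a ∷ s) zero    = m≤m⊔n a (maxV s)
  lookup≤maxV (a ∷ s) (suc i) = ≤-trans (lookup≤maxV s i) (m≤n⊔m a (maxV s))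

  prodV-removeAt : ∀ {m} (s : Vec ℕ (suc m)) j → prodV s ≡ lookup s j * prodV (removeAt s j)
  prodV-removeAt (a ∷ s)         zero    = refl
  prodV-removeAt (a ∷ s@(_ ∷ _)) (suc j) = trans (cong (a *_) (prodV-removeAt s j)) (swap a (lookup s j) (prodV (removeAt s j)))
    where
    swap : ∀ a b c → a * (b * c) ≡ b * (a * c)
    swap = solve-∀

  -- Replacing n^m by 2^m (n)_m makes (n)_m^P a factor of both sides, where it cancels and leaves
  -- (2^m)^P in the constant.
  sparse⇒excess≤ : ∀ {y n m c T} P → 0ℚ ℚ.≤ y → 0 < n → 2 * m ≤ n →
    y ℚ.* toℚ (falling n m) ℚ.≤ toℚ T → T ^ P * n ≤ c * (n ^ m) ^ P →
    (y ^ℚ P) ℚ.* toℚ n ℚ.≤ toℚ (c * (2 ^ m) ^ P)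
  sparse⇒excess≤ {y} {n} {m} {c} {T} P 0≤y 0<n 2m≤n yf≤T sparse =
    ℚₚ.*-cancelʳ-≤-pos (toℚ (f ^ P)) {{toℚ-pos (m^n>0 f {{>-nonZero 0<f}} P)}} (begin
      ((y ^ℚ P) ℚ.* toℚ n) ℚ.* toℚ (f ^ P)
        ≡⟨ trans (cong ((y ^ℚ P) ℚ.* toℚ n ℚ.*_) (toℚ-^ f P)) (swap (y ^ℚ P) (toℚ n) (toℚ f ^ℚ P)) ⟩
      ((y ^ℚ P) ℚ.* (toℚ f ^ℚ P)) ℚ.* toℚ n
        ≡⟨ cong (ℚ._* toℚ n) (^ℚ-distrib-* P y (toℚ f)) ⟨
      ((y ℚ.* toℚ f) ^ℚ P) ℚ.* toℚ n
        ≤⟨ ℚ-*-monoʳ (toℚ n) (0≤toℚ n) (^ℚ-mono P (0≤* 0≤y (0≤toℚ f)) yf≤T) ⟩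
      (toℚ T ^ℚ P) ℚ.* toℚ n
        ≡⟨ trans (cong (ℚ._* toℚ n) (sym (toℚ-^ T P))) (sym (toℚ-* (T ^ P) n)) ⟩
      toℚ (T ^ P * n)
        ≤⟨ toℚ-mono (≤-trans sparse (≤-trans (*-monoʳ-≤ c (^-monoˡ-≤ P (^≤falling n m 2m≤n)))
             (≤-reflexive (trans (cong (c *_) (^-distribʳ-* P (2 ^ m) f)) (sym (*-assoc c ((2 ^ m) ^ P) (f ^ P))))))) ⟩
      toℚ (c * (2 ^ m) ^ P * f ^ P)
        ≡⟨ toℚ-* (c * (2 ^ m) ^ P) (f ^ P) ⟩
      toℚ (c * (2 ^ m) ^ P) ℚ.* toℚ (f ^ P) ∎)
    where
    open ℚₚ.≤-Reasoning
    f = falling n m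
    0<f : 0 < f
    0<f = n≢0⇒n>0 (λ f≡0 → contradiction (≤-trans (m^n>0 n {{>-nonZero 0<n}} m)
      (≤-trans (^≤falling n m 2m≤n) (≤-reflexive (trans (cong (2 ^ m *_) f≡0) (*-zeroʳ (2 ^ m)))))) (λ ()))
    swap : ∀ a b c → (a ℚ.* b) ℚ.* c ≡ (a ℚ.* c) ℚ.* b
    swap = solve 3 (λ a b c → (a :* b) :* c := (a :* c) :* b) refl
      where open +-*-Solver

  module Extremal {k R m} {L : Hypergraph (suc m)} (flag : IsFlag (k ∷ R) L) (uniq : Unique (k ∷ R))
           (s : Vec ℕ (suc m)) (pos : ∀ i → 0 < lookup s i) where

    -- The bound O(n^(-δ)) raised to the power ∏ s_i, which makes both exponents integers. In the
    -- threshold, twice the number of vertices of L serves `^≤falling`, and `maxV s` ensures that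
    -- sets of s_i vertices exist.
    ExcessBound : ℚ → Set
    ExcessBound c = ∀ n → 2 * suc m + maxV s ≤ n → ∀ x → IsPi (blowup L s) n x →
      (ℚ.∣ x ℚ.- (toℚ (length (k ∷ R)) ℚ.- 1ℚ) ∣ ^ℚ prodV s) ℚ.* (toℚ n ^ℚ maxV s) ℚ.≤ c

    π-bound : ∃[ c ] ExcessBound c
    π-bound = bound-from (proj₁ (box-or-sparse s j pos)) (proj₂ (box-or-sparse s j pos))
      where
      open ℚₚ.≤-Reasoning
      j = proj₁ (∃-maxV s)
      sⱼ≡max = proj₂ (∃-maxV s)
      P = prodV (removeAt s j)
      bound-from : ∀ c → (∀ {n} (A : Vec (Fin n) (suc m) → Bool) → 0 < n → (∀ i → lookup s i ≤ n) →
        ContainsBox s A ⊎ ∑ (tuples n (suc m)) (𝟙 ∘ A) ^ P * n ≤ c * (n ^ suc m) ^ P) → ∃[ c′ ] ExcessBound c′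
      -- From y^P n ≤ D, raising to the power s_j = max s_i produces the exponents P s_j = ∏ s_i and
      -- max s_i.
      bound-from c dichotomy = toℚ (D ^ lookup s j) , bound
        where
        D = c * (2 ^ suc m) ^ P
        bound : ExcessBound (toℚ (D ^ lookup s j))
        bound n large x ((G , (sizes , free) , hG≡x) , maximal) = begin
          (ℚ.∣ y ∣ ^ℚ prodV s) ℚ.* (toℚ n ^ℚ maxV s)
            ≡⟨ cong (λ z → (z ^ℚ prodV s) ℚ.* (toℚ n ^ℚ maxV s)) (ℚₚ.0≤p⇒∣p∣≡p 0≤y) ⟩
          (y ^ℚ prodV s) ℚ.* (toℚ n ^ℚ maxV s)
            ≡⟨ cong₂ (λ a b → (y ^ℚ a) ℚ.* (toℚ n ^ℚ b)) (prodV-removeAt s j) (sym sⱼ≡max) ⟩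
          (y ^ℚ (lookup s j * P)) ℚ.* (toℚ n ^ℚ lookup s j)
            ≡⟨ cong (ℚ._* (toℚ n ^ℚ lookup s j)) (^ℚ-* y (lookup s j) P) ⟩
          ((y ^ℚ P) ^ℚ lookup s j) ℚ.* (toℚ n ^ℚ lookup s j)
            ≡⟨ ^ℚ-distrib-* (lookup s j) (y ^ℚ P) (toℚ n) ⟨
          ((y ^ℚ P) ℚ.* toℚ n) ^ℚ lookup s j
            ≤⟨ ^ℚ-mono (lookup s j) (0≤* (0≤^ℚ P 0≤y) (0≤toℚ n)) y^P*n≤D ⟩
          toℚ D ^ℚ lookup s j
            ≡⟨ toℚ-^ D (lookup s j) ⟨
          toℚ (D ^ lookup s j) ∎
          where
          2m≤n : 2 * suc m ≤ n
          2m≤n = ≤-trans (m≤m+n (2 * suc m) (maxV s)) large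
          m≤n : suc m ≤ n
          m≤n = ≤-trans (m≤m+n (suc m) (suc m + 0)) 2m≤n
          s≤n : ∀ i → lookup s i ≤ n
          s≤n i = ≤-trans (lookup≤maxV s i) (≤-trans (m≤n+m (maxV s) (2 * suc m)) large)
          0<n : 0 < n
          0<n = ≤-trans (s≤s z≤n) m≤n
          -- Every size in R is the size of an edge of L, hence at most the number of vertices of L.
          R≤n : All (_≤ n) R
          R≤n = All.tabulate (λ {a} a∈R → let F , _ , ∣F∣≡a , _ = proj₁ flag a (there a∈R) in
            ≤-trans (≤-reflexive (sym ∣F∣≡a)) (≤-trans (∣p∣≤n F) m≤n))
          r-1 = toℚ (length (k ∷ R)) ℚ.- 1ℚ
          y = x ℚ.- r-1
          r-1≤x : r-1 ℚ.≤ x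
          r-1≤x = begin
            toℚ (suc (length R)) ℚ.- 1ℚ        ≡⟨ cong (ℚ._- 1ℚ) (toℚ-+ 1 (length R)) ⟩
            (1ℚ ℚ.+ toℚ (length R)) ℚ.- 1ℚ     ≡⟨ p+q-p≡q 1ℚ (toℚ (length R)) ⟩
            toℚ (length R)                     ≤⟨ h-withSizes n R (AllPairs.tail uniq) R≤n ⟩
            h (withSizes R {n})                ≤⟨ maximal (withSizes R) (withSizes-admissible flag uniq s pos n) ⟩
            x                                  ∎
          -- The lower bound on x removes the absolute value and makes powers of y monotone.
          0≤y : 0ℚ ℚ.≤ y
          0≤y = subst (ℚ._≤ y) (ℚₚ.+-inverseʳ r-1) (ℚₚ.+-monoˡ-≤ (ℚ.- r-1) r-1≤x)
          sparse : ∑ (tuples n (suc m)) (𝟙 ∘ copyᵇ L G) ^ P * n ≤ c * (n ^ suc m) ^ P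
          sparse = [ (λ box → contradiction (box⇒blowup L G s pos box) free) , id ]′ (dichotomy (copyᵇ L G) 0<n s≤n)
          y^P*n≤D : (y ^ℚ P) ℚ.* toℚ n ℚ.≤ toℚ D
          y^P*n≤D = sparse⇒excess≤ {m = suc m} {c} {∑ (tuples n (suc m)) (𝟙 ∘ copyᵇ L G)} P 0≤y 0<n 2m≤n
            (subst (λ z → (z ℚ.- r-1) ℚ.* toℚ (falling n (suc m)) ℚ.≤ toℚ (∑ (tuples n (suc m)) (𝟙 ∘ copyᵇ L G)))
              hG≡x (excess≤copies flag s pos G sizes)) sparse

    ∃-π : ∀ n → ∃[ x ] IsPi (blowup L s) n x
    ∃-π n = ∃-IsPi (blowup L s) (withSizes R) (withSizes-admissible flag uniq s pos n)

open import Data.Nat using (ℕ; _≤_; _<_; _∸_)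
open import Data.Vec using (Vec)
open import Data.Vec.Relation.Unary.All using () renaming (All to AllV)
open import Data.List using (List; length)
open import Data.List.Relation.Unary.All using (All)
open import Data.List.Relation.Unary.Unique.Propositional using (Unique)
open import Data.Product using (∃-syntax; _×_)
open import Data.Rational using (ℚ; 1ℚ; ∣_∣; _-_; _*_) renaming (_≤_ to _≤ℚ_)
open import Data.Fin.Subset.Properties using (∣p∣≤n)
open import Data.List.Relation.Unary.All using (_∷_)
open import Data.List.Relation.Unary.Any using (here)
open import Data.Nat.Properties using (<⇒≱)
open import Data.Product using (_,_; proj₁; proj₂)
open import Data.Vec.Membership.Propositional.Properties using (∈-lookup)
import Data.Vec.Relation.Unary.All as VecAll
open import Relation.Binary.PropositionalEquality using (refl; subst)
open import Relation.Nullary using (contradiction)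

theorem5p4 : (R : List ℕ) → 0 < length R → Unique R → All (0 <_) R →
    (m : ℕ) (L : Hypergraph m) → IsFlag R L →
    (s : Vec ℕ m) → AllV (0 <_) s →
    ∃[ C ] ∃[ N ] ((n : ℕ) → N ≤ n →
    ∃[ x ] (IsPi (blowup L s) n x ×
    (∣ x - (toℚ (length R) - 1ℚ) ∣ ^ℚ prodV s) * (toℚ n ^ℚ maxV s) ≤ℚ C))
-- Without vertices there is no edge of positive size, so this case cannot occur, and otherwise some
-- part with the largest s_j exists.
theorem5p4 (k List.∷ R) _ uniq (0<k ∷ _) ℕ.zero L (edge , _) s s-pos =
  let F , _ , ∣F∣≡k , _ = edge k (here refl) in contradiction (subst (_≤ 0) ∣F∣≡k (∣p∣≤n F)) (<⇒≱ 0<k)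
-- The threshold left to inference is the one in `ExcessBound`.
theorem5p4 (k List.∷ R) _ uniq _ (ℕ.suc m) L flag s s-pos = proj₁ π-bound , _ , λ n N≤n →
  let x , isPi = ∃-π n in x , isPi , proj₂ π-bound n N≤n x isPi
  where
  open FlagBlowup using (module Extremal)
  open Extremal flag uniq s (λ i → VecAll.lookup s-pos (∈-lookup i s))
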